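{- Let $R$ be a Dedekind ring with quotient field $K$, let $a\in R$ be square-free such that $f(x)=x^n-a$ is irreducible over $R$, and let $\alpha$ be a root of $f(x)$. If every prime ideal of $R$ that contains $n\cdot 1_K$ also contains $a$, then $R[\alpha]$ is integrally closed (in $K(\alpha)$).
   Context: An element $a$ of a Dedekind ring $R$ is square-free if the principal ideal $aR$ is not divisible by the square of any prime ideal of $R$. -}

module Defs where

open import Algebra.Bundles using (CommutativeRing; RawSemiring)
import Algebra.Definitions.RawSemiring as RawSemiringDefinitions
open import Algebra.Morphism.Structures using (module RingMorphisms)
open import Data.List.Base using (List; []; _∷_; map; foldr; length)
import Data.List.Membership.Setoid as SetoidMembership
open import Data.List.Relation.Unary.All using (All)
open import Data.Nat.Base using (ℕ; zero; suc)
open import Data.Product.Base using (∃; ∃₂; _×_)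
open import Data.Sum.Base using (_⊎_)
open import Level using (Level) renaming (suc to lsuc)
open import Data.Unit.Polymorphic.Base using (⊤)
open import Relation.Nullary.Negation.Core using (¬_)
open import Relation.Unary using (Pred; _∈_; _∉_; _⊆_; _≐_)

private
  variable
    ℓ : Level

-- Elements and ideals live at one common level ℓ, so that ideals generated by
-- subsets of the ring are again predicates at level ℓ.

------------------------------------------------------------------------
-- Domains, fields and ideals

module _ (R : CommutativeRing ℓ ℓ) where
  open CommutativeRing R

  record IsDomain : Set ℓ where
    field
      0≉1             : ¬ (0# ≈ 1#)
      noZeroDivisors  : ∀ x y → x * y ≈ 0# → x ≈ 0# ⊎ y ≈ 0#

  record IsField : Set ℓ where
    field
      0≉1     : ¬ (0# ≈ 1#)
      inverse : ∀ x → ¬ (x ≈ 0#) → ∃ λ y → x * y ≈ 1#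

  record IsIdeal (I : Pred Carrier ℓ) : Set ℓ where
    field
      resp     : ∀ {x y} → x ≈ y → x ∈ I → y ∈ I
      0∈       : 0# ∈ I
      +-closed : ∀ {x y} → x ∈ I → y ∈ I → x + y ∈ I
      *-closed : ∀ r {x} → x ∈ I → r * x ∈ I

  data Generated (S : Pred Carrier ℓ) : Pred Carrier ℓ where
    gen      : ∀ {x} → x ∈ S → Generated S x
    resp     : ∀ {x y} → x ≈ y → Generated S x → Generated S y
    0∈       : Generated S 0#
    +-closed : ∀ {x y} → Generated S x → Generated S y → Generated S (x + y)
    *-closed : ∀ r {x} → Generated S x → Generated S (r * x)

  PrincipalIdeal : Carrier → Pred Carrier ℓ
  PrincipalIdeal a = Generated (a ≈_)

  IdealProduct : Pred Carrier ℓ → Pred Carrier ℓ → Pred Carrier ℓ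
  IdealProduct I J = Generated (λ z → ∃₂ λ x y → x ∈ I × y ∈ J × z ≈ x * y)

  IdealDivides : Pred Carrier ℓ → Pred Carrier ℓ → Set (lsuc ℓ)
  IdealDivides J I = ∃ λ C → IsIdeal C × I ≐ IdealProduct J C

  record IsPrimeIdeal (P : Pred Carrier ℓ) : Set ℓ where
    field
      isIdeal : IsIdeal P
      1∉      : 1# ∉ P
      prime   : ∀ x y → x * y ∈ P → x ∈ P ⊎ y ∈ P

  record IsMaximalIdeal (M : Pred Carrier ℓ) : Set (lsuc ℓ) where
    field
      isIdeal : IsIdeal M
      1∉      : 1# ∉ M
      maximal : ∀ J → IsIdeal J → M ⊆ J → J ⊆ M ⊎ 1# ∈ J

  IsNoetherian : Set (lsuc ℓ)
  IsNoetherian = ∀ I → IsIdeal I →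
    ∃ λ (xs : List Carrier) → I ≐ Generated (λ x → SetoidMembership._∈_ setoid x xs)

  -- The zero ideal counts as a prime ideal here, so 0 is not square-free in a
  -- domain; for a ≉ 0 the zero ideal imposes no condition.
  SquareFree : Carrier → Set (lsuc ℓ)
  SquareFree a = ∀ P → IsPrimeIdeal P → ¬ IdealDivides (IdealProduct P P) (PrincipalIdeal a)

------------------------------------------------------------------------
-- Polynomials

-- A polynomial is its list of coefficients, constant term first; trailing
-- zeros are immaterial because equality compares coefficients.
module Polynomial (R : CommutativeRing ℓ ℓ) where
  open CommutativeRing R

  Poly : Set ℓ
  Poly = List Carrier

  coeff : Poly → ℕ → Carrier
  coeff []      _       = 0#
  coeff (c ∷ p) zero    = c
  coeff (c ∷ p) (suc i) = coeff p i

  infix  4 _≈ₚ_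
  infixl 6 _+ₚ_
  infixl 7 _*ₚ_

  _≈ₚ_ : Poly → Poly → Set ℓ
  p ≈ₚ q = ∀ i → coeff p i ≈ coeff q i

  _+ₚ_ : Poly → Poly → Poly
  []      +ₚ q       = q
  (c ∷ p) +ₚ []      = c ∷ p
  (c ∷ p) +ₚ (d ∷ q) = (c + d) ∷ (p +ₚ q)

  _*ₚ_ : Poly → Poly → Poly
  []      *ₚ q = []
  (c ∷ p) *ₚ q = map (c *_) q +ₚ (0# ∷ (p *ₚ q))

  polyRawSemiring : RawSemiring ℓ ℓ
  polyRawSemiring = record
    { Carrier = Poly
    ; _≈_     = _≈ₚ_
    ; _+_     = _+ₚ_
    ; _*_     = _*ₚ_
    ; 0#      = []
    ; 1#      = 1# ∷ []
    }

  open RawSemiringDefinitions polyRawSemiring public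
    using (Irreducible; _^_)

  const : Carrier → Poly
  const c = c ∷ []

  X : Poly
  X = 0# ∷ 1# ∷ []

  X^_-_ : ℕ → Carrier → Poly
  X^ n - a = (X ^ n) +ₚ const (- a)

  eval : Poly → Carrier → Carrier
  eval p x = foldr (λ c v → c + x * v) 0# p

------------------------------------------------------------------------
-- Integral elements

module _ (B : CommutativeRing ℓ ℓ) where
  open CommutativeRing B
  open Polynomial B using (Poly; eval)
  open import Algebra.Properties.Semiring.Exp semiring using (_^_)

  -- p holds the non-leading coefficients c₀ , … , cₘ₋₁ of the monic polynomial
  -- xᵐ + cₘ₋₁ xᵐ⁻¹ + … + c₀, where m = length p.
  IsIntegralOver : Pred Carrier ℓ → Carrier → Set ℓ
  IsIntegralOver S x = ∃ λ (p : Poly) → All S p × x ^ length p + eval p x ≈ 0#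

  IntegrallyClosedIn : Pred Carrier ℓ → Pred Carrier ℓ → Set ℓ
  IntegrallyClosedIn S T = ∀ x → x ∈ T → IsIntegralOver S x → x ∈ S

------------------------------------------------------------------------
-- Extensions of rings

module _ (A B : CommutativeRing ℓ ℓ) where
  private
    module A = CommutativeRing A
    module B = CommutativeRing B

  IsEmbedding : (A.Carrier → B.Carrier) → Set ℓ
  IsEmbedding = RingMorphisms.IsRingMonomorphism A.rawRing B.rawRing

  module _ (φ : A.Carrier → B.Carrier) where

    Image : Pred B.Carrier ℓ
    Image y = ∃ λ x → y B.≈ φ x

    evalAt : Polynomial.Poly A → B.Carrier → B.Carrier
    evalAt p = Polynomial.eval B (map φ p)

    -- A[α]
    Adjoin : B.Carrier → Pred B.Carrier ℓ
    Adjoin α y = ∃ λ p → y B.≈ evalAt p α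

    -- A(α), for fields A and B
    AdjoinField : B.Carrier → Pred B.Carrier ℓ
    AdjoinField α y =
      ∃₂ λ p q → ¬ (evalAt q α B.≈ B.0#) × y B.* evalAt q α B.≈ evalAt p α

    record IsQuotientField : Set ℓ where
      field
        isField     : IsField B
        isEmbedding : IsEmbedding φ
        fraction    : ∀ y → ∃₂ λ r s → ¬ (s A.≈ A.0#) × y B.* φ s B.≈ φ r

------------------------------------------------------------------------
-- Dedekind rings

-- R is a Dedekind ring with quotient field K. Fields are allowed as R.
record IsDedekindWithQuotientField
    (R K : CommutativeRing ℓ ℓ)
    (ι : CommutativeRing.Carrier R → CommutativeRing.Carrier K) : Set (lsuc ℓ) where
  open CommutativeRing R
  field
    isDomain         : IsDomain R
    isQuotientField  : IsQuotientField R K ι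
    isNoetherian     : IsNoetherian R
    integrallyClosed : IntegrallyClosedIn K (Image R K ι) (λ _ → ⊤)
    primesMaximal    : ∀ P → IsPrimeIdeal R P → (∃ λ x → x ∈ P × ¬ (x ≈ 0#)) →
                       IsMaximalIdeal R P

{-# OPTIONS --safe #-}

-- Call y ∈ K(α) almost integral if d yᵏ ∈ A = R[α] for some nonzero d ∈ R and all k.
-- Every y ∈ K(α) integral over A is almost integral, and an almost integral element of
-- K lies in R.  If some almost integral y is not in A, choose one, β, with maximal
-- annihilator P = {r ∈ R : r β ∈ A}; then P is a nonzero prime, and c P ⊆ π R for some
-- c ∉ P and π ∈ P.
--
-- If a ∉ P, then n ∉ P, so xⁿ - a is separable modulo P and A/PA is reduced.  A power of
-- z = π β lies in PA, hence so does z, and c β ∈ A, a contradiction.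
--
-- If a ∈ P, then αⁿ β = a β ∈ A, so some γ = αʲ β ∉ A has α γ ∈ A, and modulo A it is
-- r/α with r ∈ R.  Since (r/α)ⁿ = rⁿ/a is almost integral, a divides rⁿ and r ∈ P.
-- Square-freeness gives c a = π a′ with a′ ∉ P, so that a′ c γ ∈ A, contradicting the
-- maximality of P.

module Submission where

open import Defs hiding (resp; 0∈; +-closed; *-closed)
open import Level using (Level; suc; lift; lower)
open import Algebra.Bundles using (CommutativeRing; RawSemiring)
open import Algebra.Definitions.RawMonoid using (_×_)
import Algebra.Definitions.RawMagma as RawMagmaDefinitions
import Algebra.Morphism.Construct.Composition as Composition
open import Algebra.Morphism.Structures using (module RingMorphisms)
import Algebra.Properties.CommutativeSemiring.Exp as CommutativeExp
import Algebra.Properties.Ring as RingProperties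
import Algebra.Properties.Semiring.Exp as Exp
import Algebra.Properties.Semiring.Mult.TCOptimised as SemiringMult
import Algebra.Solver.Ring as RingSolver
open import Algebra.Solver.Ring.AlmostCommutativeRing using (fromCommutativeRing; _-Raw-AlmostCommutative⟶_)
open import Axiom.ExcludedMiddle using (ExcludedMiddle)
open import Data.Empty using (⊥; ⊥-elim)
open import Data.Integer.Base as ℤ using (ℤ; +_; -[1+_]; _⊖_)
import Data.Integer.Properties as ℤ
open import Data.List.Base using ([]; _∷_; map; length)
import Data.List.Membership.Setoid as SetoidMembership
open import Data.List.Properties using (length-map; map-∘)
open import Data.List.Relation.Unary.All using (All; []; _∷_)
open import Data.List.Relation.Unary.Any using (here; there)
open import Data.Maybe.Base using (Maybe; just; nothing)
open import Data.Nat.Base as ℕ using (ℕ; zero; _≤_; _<_; z≤n; s≤s)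
import Data.Nat.Properties as ℕ
open import Data.Product.Base using (∃; _,_; proj₁; proj₂) renaming (_×_ to _∧_)
open import Data.Sum.Base as Sum using (_⊎_; inj₁; inj₂)
open import Data.Unit.Polymorphic.Base using (⊤; tt)
open import Function.Base using (_∘_)
open import Relation.Binary.PropositionalEquality.Core as ≡ using (_≡_)
open import Relation.Binary.Bundles using (Setoid)
import Relation.Binary.Reasoning.Setoid as SetoidReasoning
open import Relation.Binary.Structures using (IsEquivalence)
open import Relation.Nullary.Decidable using (map′)
open import Relation.Nullary.Decidable.Core using (Dec; yes; no)
open import Relation.Nullary.Negation.Core using (¬_)
open import Relation.Unary using (Pred; _⊆_)

-- No localisation, quotient ring or quotient module is formed. The local ring at P is replaced by a
-- pair c ∉ P, π ∈ P with c P ⊆ π R, where c acts as a unit and π as a uniformizer. An argument by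
-- P-adic valuation becomes the remark that c/π, which is not in R, cannot map into itself a subset
-- of R that contains a nonzero element, since it would then be integral over R. Denominators of
-- integral elements enter only through the condition d yᵏ ∈ A, which multiplication by A and
-- subtraction of elements of A preserve with the same d.
--
-- Irreducibility is given over R only, whereas A ∩ K = R rests on the independence of 1, α, ...,
-- αⁿ⁻¹ over K. Gauss's lemma bridges this: the minimal polynomial of α over K is a monic factor of
-- f, so its coefficients lie in R. As R need not be factorial, contents are ideals and are compared
-- one prime at a time.
--
-- Separability modulo P takes the form α f′(α) = n a for f = xⁿ - a.

private
  variable
    ℓ : Level

-- With integer coefficients, the solver recognises cancellation in an arbitrary
-- commutative ring.
module IntegerSolver (R : CommutativeRing ℓ ℓ) where
  open CommutativeRing R
  open RingProperties ring
  open SemiringMult semiring renaming (_×_ to _⋅_)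
  open SetoidReasoning setoid

  private
    ⟦_⟧ : ℤ → Carrier
    ⟦ + n ⟧      = n ⋅ 1#
    ⟦ -[1+ n ] ⟧ = - (ℕ.suc n ⋅ 1#)

    ⊖-homo : ∀ m n → ⟦ m ⊖ n ⟧ ≈ m ⋅ 1# - n ⋅ 1#
    ⊖-homo m zero = sym (trans (+-congˡ -0#≈0#) (+-identityʳ _))
    ⊖-homo zero (ℕ.suc n) = sym (+-identityˡ _)
    ⊖-homo (ℕ.suc m) (ℕ.suc n) = begin
      ⟦ ℕ.suc m ⊖ ℕ.suc n ⟧                     ≡⟨ ≡.cong ⟦_⟧ (ℤ.[1+m]⊖[1+n]≡m⊖n m n) ⟩
      ⟦ m ⊖ n ⟧                                 ≈⟨ ⊖-homo m n ⟩
      m ⋅ 1# - n ⋅ 1#                           ≈⟨ +-congʳ (+-identityʳ _) ⟨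
      m ⋅ 1# + 0# - n ⋅ 1#                      ≈⟨ +-congʳ (+-congˡ (-‿inverseʳ 1#)) ⟨
      m ⋅ 1# + (1# - 1#) - n ⋅ 1#               ≈⟨ +-congʳ (+-assoc _ _ _) ⟨
      m ⋅ 1# + 1# - 1# - n ⋅ 1#                 ≈⟨ +-congʳ (+-congʳ (+-comm _ _)) ⟩
      1# + m ⋅ 1# - 1# - n ⋅ 1#                 ≈⟨ +-assoc _ _ _ ⟩
      1# + m ⋅ 1# + (- 1# - n ⋅ 1#)             ≈⟨ +-congˡ (-‿+-comm 1# (n ⋅ 1#)) ⟩
      1# + m ⋅ 1# - (1# + n ⋅ 1#)               ≈⟨ +-cong (1+× m 1#) (-‿cong (1+× n 1#)) ⟨
      ℕ.suc m ⋅ 1# - ℕ.suc n ⋅ 1#               ∎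

    -‿homo : ∀ i → ⟦ ℤ.- i ⟧ ≈ - ⟦ i ⟧
    -‿homo (+ zero)      = sym -0#≈0#
    -‿homo (+ ℕ.suc n)   = refl
    -‿homo -[1+ n ]      = sym (-‿involutive _)

    +-homo : ∀ i j → ⟦ i ℤ.+ j ⟧ ≈ ⟦ i ⟧ + ⟦ j ⟧
    +-homo (+ m) (+ n)         = ×-homo-+ 1# m n
    +-homo (+ m) -[1+ n ]      = ⊖-homo m (ℕ.suc n)
    +-homo -[1+ m ] (+ n)      = trans (⊖-homo n (ℕ.suc m)) (+-comm _ _)
    +-homo -[1+ m ] -[1+ n ]   = begin
      - (ℕ.suc (ℕ.suc (m ℕ.+ n)) ⋅ 1#)         ≡⟨ ≡.cong (λ k → - (ℕ.suc k ⋅ 1#)) (ℕ.+-suc m n) ⟨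
      - ((ℕ.suc m ℕ.+ ℕ.suc n) ⋅ 1#)           ≈⟨ -‿cong (×-homo-+ 1# (ℕ.suc m) (ℕ.suc n)) ⟩
      - (ℕ.suc m ⋅ 1# + ℕ.suc n ⋅ 1#)          ≈⟨ -‿+-comm _ _ ⟨
      - (ℕ.suc m ⋅ 1#) - ℕ.suc n ⋅ 1#          ∎

    *-homo⁺ : ∀ i n → ⟦ i ℤ.* + n ⟧ ≈ ⟦ i ⟧ * ⟦ + n ⟧
    *-homo⁺ (+ m) n = begin
      ⟦ + m ℤ.* + n ⟧  ≡⟨ ≡.cong ⟦_⟧ (ℤ.pos-* m n) ⟨
      (m ℕ.* n) ⋅ 1#   ≈⟨ ×1-homo-* m n ⟩
      m ⋅ 1# * n ⋅ 1#  ∎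
    *-homo⁺ -[1+ m ] n = begin
      ⟦ -[1+ m ] ℤ.* + n ⟧            ≡⟨ ≡.cong ⟦_⟧ (ℤ.neg-distribˡ-* (+ ℕ.suc m) (+ n)) ⟨
      ⟦ ℤ.- (+ ℕ.suc m ℤ.* + n) ⟧     ≈⟨ -‿homo (+ ℕ.suc m ℤ.* + n) ⟩
      - ⟦ + ℕ.suc m ℤ.* + n ⟧         ≈⟨ -‿cong (*-homo⁺ (+ ℕ.suc m) n) ⟩
      - (ℕ.suc m ⋅ 1# * n ⋅ 1#)       ≈⟨ -‿distribˡ-* _ _ ⟩
      - (ℕ.suc m ⋅ 1#) * n ⋅ 1#       ∎

    *-homo : ∀ i j → ⟦ i ℤ.* j ⟧ ≈ ⟦ i ⟧ * ⟦ j ⟧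
    *-homo i (+ n) = *-homo⁺ i n
    *-homo i -[1+ n ] = begin
      ⟦ i ℤ.* -[1+ n ] ⟧              ≡⟨ ≡.cong ⟦_⟧ (ℤ.neg-distribʳ-* i (+ ℕ.suc n)) ⟨
      ⟦ ℤ.- (i ℤ.* + ℕ.suc n) ⟧       ≈⟨ -‿homo (i ℤ.* + ℕ.suc n) ⟩
      - ⟦ i ℤ.* + ℕ.suc n ⟧           ≈⟨ -‿cong (*-homo⁺ i (ℕ.suc n)) ⟩
      - (⟦ i ⟧ * ℕ.suc n ⋅ 1#)        ≈⟨ -‿distribʳ-* _ _ ⟩
      ⟦ i ⟧ * - (ℕ.suc n ⋅ 1#)        ∎

    ℤ⟶R : ℤ.+-*-rawRing -Raw-AlmostCommutative⟶ fromCommutativeRing R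
    ℤ⟶R = record
      { ⟦_⟧ = ⟦_⟧ ; +-homo = +-homo ; *-homo = *-homo ; -‿homo = -‿homo
      ; 0-homo = refl ; 1-homo = refl }

    _≟_ : ∀ i j → Maybe (⟦ i ⟧ ≈ ⟦ j ⟧)
    i ≟ j with i ℤ.≟ j
    ... | yes ≡.refl = just refl
    ... | no _       = nothing

  open RingSolver ℤ.+-*-rawRing (fromCommutativeRing R) ℤ⟶R _≟_ public
    using (solve; _:=_; _:+_; _:*_; _:-_; :-_)
    renaming (con to conℤ)

  :0 :1 : ∀ {n} → RingSolver.Polynomial ℤ.+-*-rawRing (fromCommutativeRing R) ℤ⟶R _≟_ n
  :0 = conℤ (+ 0)
  :1 = conℤ (+ 1)

-- The ring of polynomials given by coefficient lists

module PolynomialRing {ℓ : Level} (R : CommutativeRing ℓ ℓ) where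
  open CommutativeRing R
  open RingProperties ring
  open Polynomial R public

  -- A record, because _≈ₚ_ is a function type from which Agda cannot infer p and q.
  infix 4 _≋_
  record _≋_ (p q : Poly) : Set ℓ where
    constructor ≈⇒≋
    field ≋⇒≈ : p ≈ₚ q
  open _≋_ public

  infix 8 -ₚ_
  -ₚ_ : Poly → Poly
  -ₚ_ = map (-_)

  scale : Carrier → Poly → Poly
  scale c = map (c *_)

  ≋-refl : ∀ {p} → p ≋ p
  ≋-refl = ≈⇒≋ λ _ → refl

  ≋-sym : ∀ {p q} → p ≋ q → q ≋ p
  ≋-sym (≈⇒≋ e) = ≈⇒≋ λ i → sym (e i)

  ≋-trans : ∀ {p q r} → p ≋ q → q ≋ r → p ≋ r
  ≋-trans (≈⇒≋ e) (≈⇒≋ e′) = ≈⇒≋ λ i → trans (e i) (e′ i)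

  infixr 5 _∷-cong_
  _∷-cong_ : ∀ {c d p q} → c ≈ d → p ≋ q → c ∷ p ≋ d ∷ q
  c≈d ∷-cong ≈⇒≋ e = ≈⇒≋ λ { zero → c≈d ; (ℕ.suc i) → e i }

  0∷-[] : 0# ∷ [] ≋ []
  0∷-[] = ≈⇒≋ λ { zero → refl ; (ℕ.suc i) → refl }

  coeff-+ : ∀ p q i → coeff (p +ₚ q) i ≈ coeff p i + coeff q i
  coeff-+ []      q       i         = sym (+-identityˡ _)
  coeff-+ (c ∷ p) []      i         = sym (+-identityʳ _)
  coeff-+ (c ∷ p) (d ∷ q) zero      = refl
  coeff-+ (c ∷ p) (d ∷ q) (ℕ.suc i) = coeff-+ p q i

  coeff-scale : ∀ c p i → coeff (scale c p) i ≈ c * coeff p i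
  coeff-scale c []      i         = sym (zeroʳ c)
  coeff-scale c (d ∷ p) zero      = refl
  coeff-scale c (d ∷ p) (ℕ.suc i) = coeff-scale c p i

  coeff-neg : ∀ p i → coeff (-ₚ p) i ≈ - coeff p i
  coeff-neg []      i         = sym -0#≈0#
  coeff-neg (d ∷ p) zero      = refl
  coeff-neg (d ∷ p) (ℕ.suc i) = coeff-neg p i

  private
    module S = IntegerSolver R
    open S using (solve; _:=_; _:+_; _:*_)

    +ₚ-cong : ∀ {p p′ q q′} → p ≋ p′ → q ≋ q′ → p +ₚ q ≋ p′ +ₚ q′
    +ₚ-cong {p} {p′} {q} {q′} (≈⇒≋ e) (≈⇒≋ e′) = ≈⇒≋ λ i →
      trans (coeff-+ p q i) (trans (+-cong (e i) (e′ i)) (sym (coeff-+ p′ q′ i)))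

    +ₚ-assoc : ∀ p q r → (p +ₚ q) +ₚ r ≋ p +ₚ (q +ₚ r)
    +ₚ-assoc p q r = ≈⇒≋ λ i →
      trans (trans (coeff-+ (p +ₚ q) r i) (+-congʳ (coeff-+ p q i)))
        (trans (+-assoc _ _ _)
          (sym (trans (coeff-+ p (q +ₚ r) i) (+-congˡ (coeff-+ q r i)))))

    +ₚ-comm : ∀ p q → p +ₚ q ≋ q +ₚ p
    +ₚ-comm p q = ≈⇒≋ λ i →
      trans (coeff-+ p q i) (trans (+-comm _ _) (sym (coeff-+ q p i)))

    +ₚ-identityʳ : ∀ p → p +ₚ [] ≋ p
    +ₚ-identityʳ []      = ≋-refl
    +ₚ-identityʳ (c ∷ p) = ≋-refl

    -ₚ-cong : ∀ {p q} → p ≋ q → -ₚ p ≋ -ₚ q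
    -ₚ-cong {p} {q} (≈⇒≋ e) = ≈⇒≋ λ i →
      trans (coeff-neg p i) (trans (-‿cong (e i)) (sym (coeff-neg q i)))

    -ₚ-inverseʳ : ∀ p → p +ₚ -ₚ p ≋ []
    -ₚ-inverseʳ p = ≈⇒≋ λ i →
      trans (coeff-+ p (-ₚ p) i) (trans (+-congˡ (coeff-neg p i)) (-‿inverseʳ _))

    scale-cong : ∀ {c d p q} → c ≈ d → p ≋ q → scale c p ≋ scale d q
    scale-cong {c} {d} {p} {q} c≈d (≈⇒≋ e) = ≈⇒≋ λ i →
      trans (coeff-scale c p i) (trans (*-cong c≈d (e i)) (sym (coeff-scale d q i)))

    scale-+ₚ : ∀ c p q → scale c (p +ₚ q) ≋ scale c p +ₚ scale c q
    scale-+ₚ c p q = ≈⇒≋ λ i →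
      trans (trans (coeff-scale c (p +ₚ q) i) (*-congˡ (coeff-+ p q i)))
        (trans (distribˡ _ _ _)
          (sym (trans (coeff-+ (scale c p) (scale c q) i)
            (+-cong (coeff-scale c p i) (coeff-scale c q i)))))

    scale-scale : ∀ c d p → scale c (scale d p) ≋ scale (c * d) p
    scale-scale c d p = ≈⇒≋ λ i →
      trans (trans (coeff-scale c (scale d p) i) (*-congˡ (coeff-scale d p i)))
        (trans (sym (*-assoc _ _ _)) (sym (coeff-scale (c * d) p i)))

    scale-0 : ∀ p → scale 0# p ≋ []
    scale-0 p = ≈⇒≋ λ i → trans (coeff-scale 0# p i) (zeroˡ _)

    scale-1 : ∀ p → scale 1# p ≋ p
    scale-1 p = ≈⇒≋ λ i → trans (coeff-scale 1# p i) (*-identityˡ _)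

    +ₚ-interchange : ∀ p q r s → (p +ₚ q) +ₚ (r +ₚ s) ≋ (p +ₚ r) +ₚ (q +ₚ s)
    +ₚ-interchange p q r s = ≈⇒≋ λ i →
      trans (expand p q r s i)
        (trans (solve 4 (λ a b c d → (a :+ b) :+ (c :+ d) := (a :+ c) :+ (b :+ d)) refl
                 (coeff p i) (coeff q i) (coeff r i) (coeff s i))
          (sym (expand p r q s i)))
      where
      expand : ∀ p q r s i → coeff ((p +ₚ q) +ₚ (r +ₚ s)) i
                             ≈ (coeff p i + coeff q i) + (coeff r i + coeff s i)
      expand p q r s i = trans (coeff-+ (p +ₚ q) (r +ₚ s) i)
                           (+-cong (coeff-+ p q i) (coeff-+ r s i))

    0∷-+ₚ : ∀ p q → 0# ∷ (p +ₚ q) ≋ (0# ∷ p) +ₚ (0# ∷ q)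
    0∷-+ₚ p q = sym (+-identityˡ 0#) ∷-cong ≋-refl

  ≋-isEquivalence : IsEquivalence _≋_
  ≋-isEquivalence = record { refl = ≋-refl ; sym = ≋-sym ; trans = ≋-trans }

  private
    ≋-setoid : Setoid ℓ ℓ
    ≋-setoid = record { isEquivalence = ≋-isEquivalence }

    open SetoidReasoning ≋-setoid

    *ₚ-congʳ : ∀ p {q q′} → q ≋ q′ → p *ₚ q ≋ p *ₚ q′
    *ₚ-congʳ []      e = ≋-refl
    *ₚ-congʳ (c ∷ p) e = +ₚ-cong (scale-cong refl e) (refl ∷-cong *ₚ-congʳ p e)

    *ₚ-distribˡ : ∀ p q r → p *ₚ (q +ₚ r) ≋ (p *ₚ q) +ₚ (p *ₚ r)
    *ₚ-distribˡ []      q r = ≋-refl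
    *ₚ-distribˡ (c ∷ p) q r = begin
      scale c (q +ₚ r) +ₚ (0# ∷ (p *ₚ (q +ₚ r)))
        ≈⟨ +ₚ-cong (scale-+ₚ c q r)
             (≋-trans (refl ∷-cong *ₚ-distribˡ p q r) (0∷-+ₚ (p *ₚ q) (p *ₚ r))) ⟩
      (scale c q +ₚ scale c r) +ₚ ((0# ∷ (p *ₚ q)) +ₚ (0# ∷ (p *ₚ r)))
        ≈⟨ +ₚ-interchange (scale c q) (scale c r) (0# ∷ (p *ₚ q)) (0# ∷ (p *ₚ r)) ⟩
      (scale c q +ₚ (0# ∷ (p *ₚ q))) +ₚ (scale c r +ₚ (0# ∷ (p *ₚ r))) ∎

    *ₚ-zeroʳ : ∀ p → p *ₚ [] ≋ []
    *ₚ-zeroʳ []      = ≋-refl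
    *ₚ-zeroʳ (c ∷ p) = ≋-trans (refl ∷-cong *ₚ-zeroʳ p) 0∷-[]

  -- `_*ₚ_` recurses on its first factor only. The mirrored recursion on the second factor makes
  -- commutativity an induction and lets `Coeffs-prime` strip either factor.
  *ₚ-∷ : ∀ p d q → p *ₚ (d ∷ q) ≋ scale d p +ₚ (0# ∷ (p *ₚ q))
  *ₚ-∷ []      d q = ≋-sym 0∷-[]
  *ₚ-∷ (c ∷ p) d q = +-congʳ (*-comm c d) ∷-cong (begin
    scale c q +ₚ (p *ₚ (d ∷ q))
      ≈⟨ +ₚ-cong (≋-refl {scale c q}) (*ₚ-∷ p d q) ⟩
    scale c q +ₚ (scale d p +ₚ (0# ∷ (p *ₚ q)))
      ≈⟨ +ₚ-assoc (scale c q) (scale d p) (0# ∷ (p *ₚ q)) ⟨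
    (scale c q +ₚ scale d p) +ₚ (0# ∷ (p *ₚ q))
      ≈⟨ +ₚ-cong (+ₚ-comm (scale c q) (scale d p)) ≋-refl ⟩
    (scale d p +ₚ scale c q) +ₚ (0# ∷ (p *ₚ q))
      ≈⟨ +ₚ-assoc (scale d p) (scale c q) (0# ∷ (p *ₚ q)) ⟩
    scale d p +ₚ (scale c q +ₚ (0# ∷ (p *ₚ q))) ∎)

  private
    *ₚ-comm : ∀ p q → p *ₚ q ≋ q *ₚ p
    *ₚ-comm []      q = ≋-sym (*ₚ-zeroʳ q)
    *ₚ-comm (c ∷ p) q = begin
      scale c q +ₚ (0# ∷ (p *ₚ q)) ≈⟨ +ₚ-cong (≋-refl {scale c q}) (refl ∷-cong *ₚ-comm p q) ⟩
      scale c q +ₚ (0# ∷ (q *ₚ p)) ≈⟨ *ₚ-∷ q c p ⟨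
      q *ₚ (c ∷ p)                 ∎

    *ₚ-cong : ∀ {p p′ q q′} → p ≋ p′ → q ≋ q′ → p *ₚ q ≋ p′ *ₚ q′
    *ₚ-cong {p} {p′} {q} {q′} e e′ = begin
      p *ₚ q   ≈⟨ *ₚ-congʳ p e′ ⟩
      p *ₚ q′  ≈⟨ *ₚ-comm p q′ ⟩
      q′ *ₚ p  ≈⟨ *ₚ-congʳ q′ e ⟩
      q′ *ₚ p′ ≈⟨ *ₚ-comm q′ p′ ⟩
      p′ *ₚ q′ ∎

    *ₚ-distribʳ : ∀ r p q → (p +ₚ q) *ₚ r ≋ (p *ₚ r) +ₚ (q *ₚ r)
    *ₚ-distribʳ r p q = begin
      (p +ₚ q) *ₚ r         ≈⟨ *ₚ-comm (p +ₚ q) r ⟩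
      r *ₚ (p +ₚ q)         ≈⟨ *ₚ-distribˡ r p q ⟩
      (r *ₚ p) +ₚ (r *ₚ q)  ≈⟨ +ₚ-cong (*ₚ-comm r p) (*ₚ-comm r q) ⟩
      (p *ₚ r) +ₚ (q *ₚ r)  ∎

    scale-*ₚ : ∀ c p q → scale c p *ₚ q ≋ scale c (p *ₚ q)
    scale-*ₚ c []      q = ≋-refl
    scale-*ₚ c (d ∷ p) q = begin
      scale (c * d) q +ₚ (0# ∷ (scale c p *ₚ q))
        ≈⟨ +ₚ-cong (≋-sym (scale-scale c d q)) (sym (zeroʳ c) ∷-cong scale-*ₚ c p q) ⟩
      scale c (scale d q) +ₚ scale c (0# ∷ (p *ₚ q))
        ≈⟨ scale-+ₚ c (scale d q) (0# ∷ (p *ₚ q)) ⟨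
      scale c (scale d q +ₚ (0# ∷ (p *ₚ q))) ∎

    0∷-*ₚ : ∀ p q → (0# ∷ p) *ₚ q ≋ 0# ∷ (p *ₚ q)
    0∷-*ₚ p q = +ₚ-cong {q = 0# ∷ (p *ₚ q)} (scale-0 q) ≋-refl

    *ₚ-assoc : ∀ p q r → (p *ₚ q) *ₚ r ≋ p *ₚ (q *ₚ r)
    *ₚ-assoc []      q r = ≋-refl
    *ₚ-assoc (c ∷ p) q r = begin
      (scale c q +ₚ (0# ∷ (p *ₚ q))) *ₚ r
        ≈⟨ *ₚ-distribʳ r (scale c q) (0# ∷ (p *ₚ q)) ⟩
      (scale c q *ₚ r) +ₚ ((0# ∷ (p *ₚ q)) *ₚ r)
        ≈⟨ +ₚ-cong (scale-*ₚ c q r) (≋-trans (0∷-*ₚ (p *ₚ q) r) (refl ∷-cong *ₚ-assoc p q r)) ⟩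
      scale c (q *ₚ r) +ₚ (0# ∷ (p *ₚ (q *ₚ r))) ∎

    *ₚ-identityˡ : ∀ p → (1# ∷ []) *ₚ p ≋ p
    *ₚ-identityˡ p = begin
      scale 1# p +ₚ (0# ∷ []) ≈⟨ +ₚ-cong (scale-1 p) 0∷-[] ⟩
      p +ₚ []                 ≈⟨ +ₚ-identityʳ p ⟩
      p                       ∎

  polyRing : CommutativeRing ℓ ℓ
  polyRing = record
    { Carrier = Poly
    ; _≈_ = _≋_
    ; _+_ = _+ₚ_
    ; _*_ = _*ₚ_
    ; -_  = -ₚ_
    ; 0#  = []
    ; 1#  = 1# ∷ []
    ; isCommutativeRing = record
      { isRing = record
        { +-isAbelianGroup = record
          { isGroup = record
            { isMonoid = record
              { isSemigroup = record
                { isMagma = record { isEquivalence = ≋-isEquivalence ; ∙-cong = +ₚ-cong }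
                ; assoc = +ₚ-assoc }
              ; identity = (λ _ → ≋-refl) , +ₚ-identityʳ }
            ; inverse = (λ p → ≋-trans (+ₚ-comm (-ₚ p) p) (-ₚ-inverseʳ p)) , -ₚ-inverseʳ
            ; ⁻¹-cong = -ₚ-cong }
          ; comm = +ₚ-comm }
        ; *-cong = *ₚ-cong
        ; *-assoc = *ₚ-assoc
        ; *-identity = *ₚ-identityˡ , λ p → ≋-trans (*ₚ-comm p _) (*ₚ-identityˡ p)
        ; distrib = *ₚ-distribˡ , *ₚ-distribʳ }
      ; *-comm = *ₚ-comm } }

  private
    module P = CommutativeRing polyRing
    module PS = IntegerSolver polyRing

  -- Degree bounds, division by monic polynomials, derivatives

  const-cong : ∀ {c d} → c ≈ d → const c ≋ const d
  const-cong c≈d = c≈d ∷-cong ≋-refl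

  const-0 : ∀ {c} → c ≈ 0# → const c ≋ []
  const-0 c≈0 = ≋-trans (const-cong c≈0) 0∷-[]

  scale-as-* : ∀ c p → scale c p ≋ const c *ₚ p
  scale-as-* c p = ≋-sym (≋-trans (+ₚ-cong (≋-refl {scale c p}) 0∷-[]) (+ₚ-identityʳ _))

  const-* : ∀ c d → const (c * d) ≋ const c *ₚ const d
  const-* c d = scale-as-* c (const d)

  X-*ₚ : ∀ p → X *ₚ p ≋ 0# ∷ p
  X-*ₚ p = ≋-trans (0∷-*ₚ (1# ∷ []) p) (refl ∷-cong *ₚ-identityˡ p)

  ∷-as-+ : ∀ c p → c ∷ p ≋ const c +ₚ X *ₚ p
  ∷-as-+ c p = ≋-trans (sym (+-identityʳ c) ∷-cong ≋-refl)
                 (+ₚ-cong (≋-refl {const c}) (≋-sym (X-*ₚ p)))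

  coeff-X* : ∀ p i → coeff (X *ₚ p) (ℕ.suc i) ≈ coeff p i
  coeff-X* p i = ≋⇒≈ (X-*ₚ p) (ℕ.suc i)

  coeff-const* : ∀ c p i → coeff (const c *ₚ p) i ≈ c * coeff p i
  coeff-const* c p i = trans (≋⇒≈ (≋-sym (scale-as-* c p)) i) (coeff-scale c p i)

  coeff-beyond : ∀ p {i} → length p ≤ i → coeff p i ≈ 0#
  coeff-beyond []      _         = refl
  coeff-beyond (c ∷ p) (s≤s l)   = coeff-beyond p l

  length-+ₚ : ∀ p q {k} → length p ≤ k → length q ≤ k → length (p +ₚ q) ≤ k
  length-+ₚ []      q       _       l       = l
  length-+ₚ (c ∷ p) []      l       _       = l
  length-+ₚ (c ∷ p) (d ∷ q) (s≤s l) (s≤s l′) = s≤s (length-+ₚ p q l l′)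

  -- A bound `length p ≤ k` means degree below k, trailing zeros being allowed. The second bound is
  -- a successor, that is degree at most e, so that the bounds add up without subtraction.
  length-*ₚ : ∀ p q {k e} → length p ≤ k → length q ≤ ℕ.suc e → length (p *ₚ q) ≤ k ℕ.+ e
  length-*ₚ []      q                     _       _  = z≤n
  length-*ₚ (c ∷ p) q {ℕ.suc k} {e} (s≤s l) l′ =
    length-+ₚ (scale c q) (0# ∷ (p *ₚ q))
      (≡.subst (_≤ ℕ.suc (k ℕ.+ e)) (≡.sym (length-map (c *_) q))
        (ℕ.≤-trans l′ (s≤s (ℕ.m≤n+m e k))))
      (s≤s (length-*ₚ p q l l′))

  length--ₚ : ∀ p {k} → length p ≤ k → length (-ₚ p) ≤ k
  length--ₚ p = ≡.subst (_≤ _) (≡.sym (length-map (-_) p))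

  length-X^ : ∀ n → length (X ^ n) ≤ ℕ.suc n
  length-X^ zero      = s≤s z≤n
  length-X^ (ℕ.suc n) = length-*ₚ X (X ^ n) ℕ.≤-refl (length-X^ n)

  X^-+ : ∀ m n → X ^ (m ℕ.+ n) ≋ (X ^ m) *ₚ (X ^ n)
  X^-+ zero      n = ≋-sym (*ₚ-identityˡ (X ^ n))
  X^-+ (ℕ.suc m) n = ≋-trans (*ₚ-congʳ X (X^-+ m n)) (≋-sym (*ₚ-assoc X (X ^ m) (X ^ n)))

  coeff-X^ : ∀ n → coeff (X ^ n) n ≈ 1#
  coeff-X^ zero      = refl
  coeff-X^ (ℕ.suc n) = trans (coeff-X* (X ^ n) n) (coeff-X^ n)

  -- Monic of degree e only if `length p ≤ e`, which is carried separately. By definition `X^ n - a`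
  -- has this form, with tail `const (- a)`.
  monic : ℕ → Poly → Poly
  monic e p = (X ^ e) +ₚ p

  length-monic : ∀ {e} p → length p ≤ e → length (monic e p) ≤ ℕ.suc e
  length-monic {e} p l = length-+ₚ (X ^ e) p (length-X^ e) (ℕ.m≤n⇒m≤1+n l)

  coeff-leading : ∀ t e p → length p ≤ e → coeff (const t *ₚ (X ^ e) +ₚ p) e ≈ t
  coeff-leading t e p l =
    trans (coeff-+ (const t *ₚ (X ^ e)) p e)
      (trans (+-cong (trans (coeff-const* t (X ^ e) e) (trans (*-congˡ (coeff-X^ e)) (*-identityʳ t)))
                     (coeff-beyond p l))
        (+-identityʳ t))

  coeff-monic : ∀ e p → length p ≤ e → coeff (monic e p) e ≈ 1#
  coeff-monic e p l = trans (coeff-+ (X ^ e) p e)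
    (trans (+-cong (coeff-X^ e) (coeff-beyond p l)) (+-identityʳ 1#))

  -- The coefficient t of x^e may be zero, so no equality has to be decided.
  split-leading : ∀ e p → length p ≤ ℕ.suc e →
                  ∃ λ t → ∃ λ q → length q ≤ e ∧ p ≋ const t *ₚ (X ^ e) +ₚ q
  split-leading e [] _ = 0# , [] , z≤n , ≋-sym
    (≋-trans (+ₚ-identityʳ _) (*ₚ-cong {q = X ^ e} 0∷-[] ≋-refl))
  split-leading zero (c ∷ _ ∷ _) (s≤s ())
  split-leading zero (c ∷ []) _ = c , [] , z≤n , ≋-sym
    (≋-trans (+ₚ-identityʳ _) (P.*-identityʳ (const c)))
  split-leading (ℕ.suc e) (c ∷ p) (s≤s l) =
    let (t , q , l′ , p≋) = split-leading e p l in
    t , c ∷ q , s≤s l′ , (begin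
      c ∷ p                                               ≈⟨ ∷-as-+ c p ⟩
      const c +ₚ X *ₚ p                                   ≈⟨ +ₚ-cong (≋-refl {const c}) (*ₚ-congʳ X p≋) ⟩
      const c +ₚ X *ₚ (const t *ₚ (X ^ e) +ₚ q)
        ≈⟨ PS.solve 5 (λ c x t y q → c PS.:+ x PS.:* (t PS.:* y PS.:+ q)
                         PS.:= t PS.:* (x PS.:* y) PS.:+ (c PS.:+ x PS.:* q)) ≋-refl
             (const c) X (const t) (X ^ e) q ⟩
      const t *ₚ (X ^ ℕ.suc e) +ₚ (const c +ₚ X *ₚ q)     ≈⟨ +ₚ-cong (≋-refl {const t *ₚ (X ^ ℕ.suc e)}) (∷-as-+ c q) ⟨
      const t *ₚ (X ^ ℕ.suc e) +ₚ (c ∷ q)                 ∎)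

  cofactor-length : ∀ e d → length d ≤ e → ∀ k u {r} → length r ≤ k ℕ.+ e →
                    u *ₚ monic e d ≋ r → ∃ λ u′ → length u′ ≤ k ∧ u ≋ u′
  cofactor-length e d ld k u {r} lr = go (length u) u ℕ.≤-refl
    where
    go : ∀ l u → length u ≤ l → u *ₚ monic e d ≋ r → ∃ λ u′ → length u′ ≤ k ∧ u ≋ u′
    go l u lu eq with l ℕ.≤? k
    go l u lu eq | yes l≤k = u , ℕ.≤-trans lu l≤k , ≋-refl
    go zero u lu eq | no l≰k = u , ℕ.≤-trans lu z≤n , ≋-refl
    go (ℕ.suc l) u lu eq | no l≰k =
      let (u′ , l′ , u≋) = go l q lq (≋-trans (*ₚ-cong (≋-sym u≋q) ≋-refl) eq)
      in u′ , l′ , ≋-trans u≋q u≋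
      where
      s = split-leading l u lu
      t = proj₁ s
      q = proj₁ (proj₂ s)
      lq = proj₁ (proj₂ (proj₂ s))
      top = const t *ₚ (X ^ l)
      rest = d *ₚ top +ₚ q *ₚ monic e d
      l-rest : length rest ≤ l ℕ.+ e
      l-rest = length-+ₚ (d *ₚ top) (q *ₚ monic e d)
        (≡.subst (length (d *ₚ top) ≤_) (ℕ.+-comm e l)
          (length-*ₚ d top ld (length-*ₚ (const t) (X ^ l) ℕ.≤-refl (length-X^ l))))
        (length-*ₚ q (monic e d) lq (length-monic d ld))
      r≋ : r ≋ const t *ₚ (X ^ (l ℕ.+ e)) +ₚ rest
      r≋ = begin
        r                                  ≈⟨ eq ⟨
        u *ₚ monic e d                     ≈⟨ *ₚ-cong (proj₂ (proj₂ (proj₂ s))) (≋-refl {monic e d}) ⟩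
        (top +ₚ q) *ₚ monic e d
          ≈⟨ PS.solve 5 (λ t x y d q → (t PS.:* x PS.:+ q) PS.:* (y PS.:+ d) PS.:=
               t PS.:* (x PS.:* y) PS.:+ (d PS.:* (t PS.:* x) PS.:+ q PS.:* (y PS.:+ d))) ≋-refl
               (const t) (X ^ l) (X ^ e) d q ⟩
        const t *ₚ ((X ^ l) *ₚ (X ^ e)) +ₚ rest
          ≈⟨ +ₚ-cong (*ₚ-congʳ (const t) (≋-sym (X^-+ l e))) (≋-refl {rest}) ⟩
        const t *ₚ (X ^ (l ℕ.+ e)) +ₚ rest ∎
      t≈0 : t ≈ 0#
      t≈0 = trans (sym (coeff-leading t (l ℕ.+ e) rest l-rest))
        (trans (sym (≋⇒≈ r≋ (l ℕ.+ e)))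
          (coeff-beyond r (ℕ.≤-trans lr (ℕ.+-monoˡ-≤ e (ℕ.≤-pred (ℕ.≰⇒> l≰k))))))
      u≋q : u ≋ q
      u≋q = ≋-trans (proj₂ (proj₂ (proj₂ s))) (+ₚ-cong {q = q} (*ₚ-cong {q = X ^ l} (const-0 t≈0) ≋-refl) ≋-refl)

  -- Subtracting x^k (x^e + d) removes the leading term of the product and leaves degree below k +
  -- e, so `cofactor-length` bounds q - x^k.
  cofactor-monic : ∀ e d → length d ≤ e → ∀ k q {r} → length r ≤ k ℕ.+ e →
                   q *ₚ monic e d ≋ monic (k ℕ.+ e) r → ∃ λ q′ → length q′ ≤ k ∧ q ≋ monic k q′
  cofactor-monic e d ld k q {r} lr eq =
    let (q′ , l , q≋) = cofactor-length e d ld k (q +ₚ -ₚ (X ^ k)) {r +ₚ -ₚ (d *ₚ (X ^ k))} lr′ eq′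
    in q′ , l , (begin
      q                              ≈⟨ PS.solve 2 (λ q x → q PS.:= x PS.:+ (q PS.:- x)) ≋-refl q (X ^ k) ⟩
      monic k (q +ₚ -ₚ (X ^ k))      ≈⟨ +ₚ-cong (≋-refl {X ^ k}) q≋ ⟩
      monic k q′                     ∎)
    where
    lr′ : length (r +ₚ -ₚ (d *ₚ (X ^ k))) ≤ k ℕ.+ e
    lr′ = length-+ₚ r _ lr (length--ₚ (d *ₚ (X ^ k))
      (≡.subst (length (d *ₚ (X ^ k)) ≤_) (ℕ.+-comm e k) (length-*ₚ d (X ^ k) ld (length-X^ k))))
    eq′ : (q +ₚ -ₚ (X ^ k)) *ₚ monic e d ≋ r +ₚ -ₚ (d *ₚ (X ^ k))
    eq′ = begin
      (q +ₚ -ₚ (X ^ k)) *ₚ monic e d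
        ≈⟨ PS.solve 3 (λ q x m → (q PS.:- x) PS.:* m PS.:= q PS.:* m PS.:- x PS.:* m) ≋-refl q (X ^ k) (monic e d) ⟩
      q *ₚ monic e d +ₚ -ₚ ((X ^ k) *ₚ monic e d)
        ≈⟨ +ₚ-cong (≋-trans eq (+ₚ-cong {q = r} (X^-+ k e) ≋-refl)) (≋-refl { -ₚ ((X ^ k) *ₚ monic e d)}) ⟩
      ((X ^ k) *ₚ (X ^ e) +ₚ r) +ₚ -ₚ ((X ^ k) *ₚ monic e d)
        ≈⟨ PS.solve 4 (λ x y r d → (x PS.:* y PS.:+ r) PS.:- x PS.:* (y PS.:+ d) PS.:= r PS.:- d PS.:* x)
             ≋-refl (X ^ k) (X ^ e) r d ⟩
      r +ₚ -ₚ (d *ₚ (X ^ k)) ∎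

  -- If r is the remainder of p, then c + x r exceeds the degree bound by at most one, and a single
  -- reduction by its coefficient t of x^e gives the remainder of c + x p.
  divide-monic : ∀ e d → length d ≤ e → ∀ p →
                 ∃ λ q → ∃ λ r → length r ≤ e ∧ p ≋ monic e d *ₚ q +ₚ r
  divide-monic e d ld [] = [] , [] , z≤n , ≋-sym (≋-trans (+ₚ-identityʳ _) (*ₚ-zeroʳ (monic e d)))
  divide-monic e d ld (c ∷ p) =
    let (q , r , lr , p≋) = divide-monic e d ld p
        (t , r′ , lr′ , r≋) = split-leading e (c ∷ r) (s≤s lr)
        m = monic e d
    in X *ₚ q +ₚ const t , r′ +ₚ -ₚ (d *ₚ const t) ,
       length-+ₚ r′ _ lr′ (length--ₚ (d *ₚ const t)
         (≡.subst (length (d *ₚ const t) ≤_) (ℕ.+-identityʳ e) (length-*ₚ d (const t) ld ℕ.≤-refl))) ,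
       (begin
         c ∷ p                              ≈⟨ ∷-as-+ c p ⟩
         const c +ₚ X *ₚ p                  ≈⟨ +ₚ-cong (≋-refl {const c}) (*ₚ-congʳ X p≋) ⟩
         const c +ₚ X *ₚ (m *ₚ q +ₚ r)
           ≈⟨ PS.solve 5 (λ c x m q r → c PS.:+ x PS.:* (m PS.:* q PS.:+ r) PS.:=
                m PS.:* (x PS.:* q) PS.:+ (c PS.:+ x PS.:* r)) ≋-refl (const c) X m q r ⟩
         m *ₚ (X *ₚ q) +ₚ (const c +ₚ X *ₚ r)
           ≈⟨ +ₚ-cong (≋-refl {m *ₚ (X *ₚ q)}) (≋-trans (≋-sym (∷-as-+ c r)) r≋) ⟩
         m *ₚ (X *ₚ q) +ₚ (const t *ₚ (X ^ e) +ₚ r′)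
           ≈⟨ PS.solve 5 (λ d xq t y r → (y PS.:+ d) PS.:* xq PS.:+ (t PS.:* y PS.:+ r) PS.:=
                (y PS.:+ d) PS.:* (xq PS.:+ t) PS.:+ (r PS.:- d PS.:* t)) ≋-refl
                d (X *ₚ q) (const t) (X ^ e) r′ ⟩
         m *ₚ (X *ₚ q +ₚ const t) +ₚ (r′ +ₚ -ₚ (d *ₚ const t)) ∎)

  -- The formal derivative in Horner form, (c + x p)′ = p + x p′, which avoids integer multiples of
  -- the coefficients.
  D : Poly → Poly
  D []      = []
  D (c ∷ p) = p +ₚ (0# ∷ D p)

  private
    ∷-tail : ∀ {c d p q} → c ∷ p ≋ d ∷ q → p ≋ q
    ∷-tail (≈⇒≋ e) = ≈⇒≋ λ i → e (ℕ.suc i)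

    []-tail : ∀ {c p} → c ∷ p ≋ [] → p ≋ []
    []-tail (≈⇒≋ e) = ≈⇒≋ λ i → e (ℕ.suc i)

    D-[] : ∀ p → p ≋ [] → D p ≋ []
    D-[] []      e = ≋-refl
    D-[] (c ∷ p) e = ≋-trans (+ₚ-cong ([]-tail e) (refl ∷-cong D-[] p ([]-tail e))) 0∷-[]

  D-cong : ∀ p q → p ≋ q → D p ≋ D q
  D-cong []      q       e = ≋-sym (D-[] q (≋-sym e))
  D-cong (c ∷ p) []      e = D-[] (c ∷ p) e
  D-cong (c ∷ p) (d ∷ q) e = +ₚ-cong (∷-tail e) (refl ∷-cong D-cong p q (∷-tail e))

  D-∷ : ∀ c p → D (c ∷ p) ≋ p +ₚ X *ₚ D p
  D-∷ c p = +ₚ-cong (≋-refl {p}) (≋-sym (X-*ₚ (D p)))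

  D-+ : ∀ p q → D (p +ₚ q) ≋ D p +ₚ D q
  D-+ []      q       = ≋-refl
  D-+ (c ∷ p) []      = ≋-sym (+ₚ-identityʳ _)
  D-+ (c ∷ p) (d ∷ q) = begin
    (p +ₚ q) +ₚ (0# ∷ D (p +ₚ q))
      ≈⟨ +ₚ-cong (≋-refl {p +ₚ q}) (≋-trans (refl ∷-cong D-+ p q) (0∷-+ₚ (D p) (D q))) ⟩
    (p +ₚ q) +ₚ ((0# ∷ D p) +ₚ (0# ∷ D q))
      ≈⟨ +ₚ-interchange p q (0# ∷ D p) (0# ∷ D q) ⟩
    (p +ₚ (0# ∷ D p)) +ₚ (q +ₚ (0# ∷ D q)) ∎

  D-scale : ∀ c p → D (scale c p) ≋ scale c (D p)
  D-scale c []      = ≋-refl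
  D-scale c (d ∷ p) = ≋-trans (+ₚ-cong (≋-refl {scale c p}) (sym (zeroʳ c) ∷-cong D-scale c p))
                        (≋-sym (scale-+ₚ c p (0# ∷ D p)))

  D-* : ∀ p q → D (p *ₚ q) ≋ D p *ₚ q +ₚ p *ₚ D q
  D-* []      q = ≋-refl
  D-* (c ∷ p) q = begin
    D (scale c q +ₚ (0# ∷ (p *ₚ q)))
      ≈⟨ D-+ (scale c q) (0# ∷ (p *ₚ q)) ⟩
    D (scale c q) +ₚ D (0# ∷ (p *ₚ q))
      ≈⟨ +ₚ-cong (≋-trans (D-scale c q) (scale-as-* c (D q))) (D-∷ 0# (p *ₚ q)) ⟩
    const c *ₚ D q +ₚ (p *ₚ q +ₚ X *ₚ D (p *ₚ q))
      ≈⟨ +ₚ-cong (≋-refl {const c *ₚ D q}) (+ₚ-cong (≋-refl {p *ₚ q}) (*ₚ-congʳ X (D-* p q))) ⟩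
    const c *ₚ D q +ₚ (p *ₚ q +ₚ X *ₚ (D p *ₚ q +ₚ p *ₚ D q))
      ≈⟨ PS.solve 6 (λ c p p′ q q′ x →
           c PS.:* q′ PS.:+ (p PS.:* q PS.:+ x PS.:* (p′ PS.:* q PS.:+ p PS.:* q′)) PS.:=
           (p PS.:+ x PS.:* p′) PS.:* q PS.:+ (c PS.:+ x PS.:* p) PS.:* q′) ≋-refl
           (const c) p (D p) q (D q) X ⟩
    (p +ₚ X *ₚ D p) *ₚ q +ₚ (const c +ₚ X *ₚ p) *ₚ D q
      ≈⟨ +ₚ-cong (*ₚ-cong {q = q} (D-∷ c p) ≋-refl) (*ₚ-cong {q = D q} (∷-as-+ c p) ≋-refl) ⟨
    D (c ∷ p) *ₚ q +ₚ (c ∷ p) *ₚ D q ∎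

-- Excluded middle and least witnesses

lower-em : ExcludedMiddle (suc ℓ) → ExcludedMiddle ℓ
lower-em em = map′ lower lift em

least : ExcludedMiddle ℓ → (Q : ℕ → Set ℓ) → ∀ n → Q n →
        ∃ λ e → e ≤ n ∧ Q e ∧ (∀ k → k < e → ¬ Q k)
least em Q n q with search n
  where
  search : ∀ n → (∃ λ e → e < n ∧ Q e ∧ (∀ k → k < e → ¬ Q k)) ⊎ (∀ k → k < n → ¬ Q k)
  search zero = inj₂ λ k ()
  search (ℕ.suc n) with search n
  ... | inj₁ (e , e<n , r) = inj₁ (e , ℕ.m≤n⇒m≤1+n e<n , r)
  ... | inj₂ none with em {Q n}
  ...   | yes q = inj₁ (n , ℕ.≤-refl , q , none)
  ...   | no ¬q = inj₂ λ k k<1+n Qk → case′ k (ℕ.m≤n⇒m<n∨m≡n (ℕ.≤-pred k<1+n)) Qk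
    where
    case′ : ∀ k → k < n ⊎ k ≡ n → ¬ Q k
    case′ k (inj₁ k<n) = none k k<n
    case′ k (inj₂ ≡.refl) = ¬q
... | inj₁ (e , e<n , r) = e , ℕ.<⇒≤ e<n , r
... | inj₂ none = n , ℕ.≤-refl , q , none

-- Ideals, and polynomials modulo an ideal

module IdealProperties (R : CommutativeRing ℓ ℓ) (I : Pred (CommutativeRing.Carrier R) ℓ)
                       (I-ideal : IsIdeal R I) where
  open CommutativeRing R
  open RingProperties ring
  open IsIdeal I-ideal public

  neg-closed : ∀ {x} → I x → I (- x)
  neg-closed {x} Ix = resp (-1*x≈-x x) (*-closed (- 1#) Ix)

  cancelˡ : ∀ {x y} → I x → I (x + y) → I y
  cancelˡ {x} {y} Ix Ixy = resp
    (IntegerSolver.solve R 2 (λ x y → (x S.:+ y) S.:- x S.:= y) refl x y)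
    (+-closed Ixy (neg-closed Ix))
    where module S = IntegerSolver R

  *-closedʳ : ∀ {x} r → I x → I (x * r)
  *-closedʳ {x} r Ix = resp (*-comm r x) (*-closed r Ix)

module CoefficientIdeal (R : CommutativeRing ℓ ℓ) (P : Pred (CommutativeRing.Carrier R) ℓ)
                        (P-ideal : IsIdeal R P) where
  open CommutativeRing R
  open PolynomialRing R
  open IsIdeal P-ideal

  -- The extension P[x] of P to polynomials. It is a record for the same reason as `_≋_`: p could
  -- not be inferred from a function type.
  record Coeffs (p : Poly) : Set ℓ where
    constructor all∈
    field coeff∈ : ∀ i → P (coeff p i)
  open Coeffs public

  Coeffs-∷ : ∀ {c p} → P c → Coeffs p → Coeffs (c ∷ p)
  Coeffs-∷ Pc Pp = all∈ λ { zero → Pc ; (ℕ.suc i) → coeff∈ Pp i }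

  Coeffs-tail : ∀ {c p} → Coeffs (c ∷ p) → Coeffs p
  Coeffs-tail Pp = all∈ (coeff∈ Pp ∘ ℕ.suc)

  Coeffs-[] : Coeffs []
  Coeffs-[] = all∈ λ _ → 0∈

  Coeffs-scale : ∀ {c} p → P c → Coeffs (scale c p)
  Coeffs-scale {c} p Pc = all∈ λ i →
    resp (trans (*-comm _ _) (sym (coeff-scale c p i))) (*-closed (coeff p i) Pc)

  Coeffs-isIdeal : IsIdeal polyRing Coeffs
  Coeffs-isIdeal = record
    { resp     = λ e Pp → all∈ λ i → resp (≋⇒≈ e i) (coeff∈ Pp i)
    ; 0∈       = Coeffs-[]
    ; +-closed = +-closed′
    ; *-closed = *-closed′
    }
    where
    +-closed′ : ∀ {p q} → Coeffs p → Coeffs q → Coeffs (p +ₚ q)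
    +-closed′ {p} {q} Pp Pq = all∈ λ i → resp (sym (coeff-+ p q i)) (+-closed (coeff∈ Pp i) (coeff∈ Pq i))

    *-closed′ : ∀ r {p} → Coeffs p → Coeffs (r *ₚ p)
    *-closed′ []      Pp = Coeffs-[]
    *-closed′ (c ∷ r) {p} Pp = +-closed′
      (all∈ λ i → resp (sym (coeff-scale c p i)) (*-closed c (coeff∈ Pp i)))
      (Coeffs-∷ 0∈ (*-closed′ r Pp))

  module Coeffsᴵ = IdealProperties polyRing Coeffs Coeffs-isIdeal

  Coeffs-const : ∀ {c} → P c → Coeffs (const c)
  Coeffs-const Pc = Coeffs-∷ Pc Coeffs-[]

  Coeffs-D : ∀ p → Coeffs p → Coeffs (D p)
  Coeffs-D []      Pp = Coeffs-[]
  Coeffs-D (c ∷ p) Pp =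
    Coeffsᴵ.+-closed (Coeffs-tail Pp) (Coeffs-∷ 0∈ (Coeffs-D p (Coeffs-tail Pp)))

  -- A constant term in P can be stripped from either factor while the product stays in P[x]. Once
  -- neither is in P, the constant coefficient c d of the product contradicts primality.
  Coeffs-prime : ExcludedMiddle ℓ → (∀ x y → P (x * y) → P x ⊎ P y) →
                 ∀ p q → Coeffs (p *ₚ q) → Coeffs p ⊎ Coeffs q
  Coeffs-prime em prime []      q       _   = inj₁ Coeffs-[]
  Coeffs-prime em prime (c ∷ p) []      _   = inj₂ Coeffs-[]
  Coeffs-prime em prime (c ∷ p) (d ∷ q) Ppq = combine em em
    (λ Pc → Sum.map₁ (Coeffs-∷ Pc) (Coeffs-prime em prime p (d ∷ q)
              (Coeffs-tail (Coeffsᴵ.cancelˡ (Coeffs-scale (d ∷ q) Pc) Ppq))))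
    (λ Pd → Sum.map₂ (Coeffs-∷ Pd) (Coeffs-prime em prime (c ∷ p) q
              (Coeffs-tail (Coeffsᴵ.cancelˡ (Coeffs-scale (c ∷ p) Pd)
                (Coeffsᴵ.resp (*ₚ-∷ (c ∷ p) d q) Ppq)))))
    where
    combine : ∀ {G : Set _} → Dec (P c) → Dec (P d) → (P c → G) → (P d → G) → G
    combine (yes Pc) _        f g = f Pc
    combine (no _)   (yes Pd) f g = g Pd
    combine (no ¬Pc) (no ¬Pd) f g =
      ⊥-elim (Sum.[ ¬Pc , ¬Pd ]′ (prime c d (resp (+-identityʳ (c * d)) (coeff∈ Ppq ℕ.zero))))

-- `inverse` makes every element outside P a unit modulo P, and an ideal V above P[x] stands for an
-- ideal of (R/P)[x], which is principal. The two cases are the zero ideal of K and a nonzero prime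
-- of the Dedekind ring.
module PrincipalModulo (R : CommutativeRing ℓ ℓ) (P : Pred (CommutativeRing.Carrier R) ℓ)
                       (P-ideal : IsIdeal R P) (em : ExcludedMiddle ℓ)
                       (inverse : ∀ c → ¬ P c → ∃ λ c′ → ∃ λ x → P x ∧
                          CommutativeRing._≈_ R
                            (CommutativeRing._+_ R (CommutativeRing._*_ R c′ c) x)
                            (CommutativeRing.1# R))
                       (V : Pred (Polynomial.Poly R) ℓ)
                       (V-ideal : IsIdeal (PolynomialRing.polyRing R) V)
                       (P⊆V : ∀ p → CoefficientIdeal.Coeffs R P P-ideal p → V p) where
  open CommutativeRing R
  open PolynomialRing R
  open CoefficientIdeal R P P-ideal
  private
    module Vᴵ = IdealProperties polyRing V V-ideal
    module PS = IntegerSolver polyRing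

  HasMonic : ℕ → Set ℓ
  HasMonic e = ∃ λ d → length d ≤ e ∧ V (monic e d)

  -- If the coefficient t of x^e were outside P, an inverse c of t modulo P would make the element
  -- monic: the error x in c t + x = 1 is repaired by adding x · x^e ∈ P[x] ⊆ V. Minimality excludes
  -- this degree. A coefficient in P is subtracted instead.
  low-degree : ∀ e → (∀ k → k < e → ¬ HasMonic k) → ∀ r → length r ≤ e → V r → Coeffs r
  low-degree zero minimal [] _ _ = Coeffs-[]
  low-degree (ℕ.suc e) minimal r lr Vr with split-leading e r lr
  ... | t , q , lq , r≋ with em {P t}
  ...   | yes Pt = Coeffsᴵ.resp (≋-sym r≋) (Coeffsᴵ.+-closed {const t *ₚ (X ^ e)} {q}
                     tX (low-degree e (λ k k<e → minimal k (ℕ.m≤n⇒m≤1+n k<e)) q lq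
                          (Vᴵ.cancelˡ {const t *ₚ (X ^ e)} {q} (P⊆V _ tX) (Vᴵ.resp r≋ Vr))))
    where
    tX : Coeffs (const t *ₚ (X ^ e))
    tX = Coeffsᴵ.*-closedʳ {const t} (X ^ e) (Coeffs-const Pt)
  ...   | no ¬Pt =
    let (c , x , Px , cx) = inverse t ¬Pt in
    ⊥-elim (minimal e ℕ.≤-refl (scale c q , ≡.subst (_≤ e) (≡.sym (length-map (c *_) q)) lq ,
      Vᴵ.resp (begin
        const c *ₚ r +ₚ (X ^ e) *ₚ const x
          ≈⟨ PP.+-congʳ (PP.*-congˡ {const c} r≋) ⟩
        const c *ₚ (const t *ₚ (X ^ e) +ₚ q) +ₚ (X ^ e) *ₚ const x
          ≈⟨ PS.solve 5 (λ c t y q x → c PS.:* (t PS.:* y PS.:+ q) PS.:+ y PS.:* x PS.:=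
               (c PS.:* t PS.:+ x) PS.:* y PS.:+ c PS.:* q) PP.refl (const c) (const t) (X ^ e) q (const x) ⟩
        (const c *ₚ const t +ₚ const x) *ₚ (X ^ e) +ₚ const c *ₚ q
          ≈⟨ PP.+-cong
               (PP.trans (PP.*-congʳ {X ^ e} (PP.trans (PP.+-congʳ {const x} (PP.sym (const-* c t))) (const-cong cx)))
                 (PP.*-identityˡ (X ^ e)))
               (PP.sym (scale-as-* c q)) ⟩
        monic e (scale c q) ∎)
      (Vᴵ.+-closed (Vᴵ.*-closed (const c) Vr)
        (P⊆V _ (Coeffsᴵ.*-closed (X ^ e) {const x} (Coeffs-const Px))))))
    where
    module PP = CommutativeRing polyRing
    open SetoidReasoning PP.setoid

  record Generator : Set ℓ where
    field
      degree  : ℕ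
      tail    : Poly
      length≤ : length tail ≤ degree
      V-monic : V (monic degree tail)
      lowest  : ∀ r → length r ≤ degree → V r → Coeffs r

    generator : Poly
    generator = monic degree tail

    divides : ∀ p → V p → ∃ λ q → ∃ λ r → Coeffs r ∧ p ≋ generator *ₚ q +ₚ r
    divides p Vp =
      let (q , r , lr , p≋) = divide-monic degree tail length≤ p in
      q , r , lowest r lr (Vᴵ.cancelˡ {generator *ₚ q} {r}
                             (Vᴵ.*-closedʳ {generator} q V-monic) (Vᴵ.resp p≋ Vp)) , p≋

  principal : ∀ n → HasMonic n → ∃ λ G → Generator.degree G ≤ n
  principal n h =
    let (e , e≤n , (d , ld , Vm) , minimal) = least em HasMonic n h in
    record { degree = e ; tail = d ; length≤ = ld ; V-monic = Vm ; lowest = low-degree e minimal } , e≤n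

-- Evaluation at α and change of coefficients

module Evaluation (A B : CommutativeRing ℓ ℓ)
                  (φ : CommutativeRing.Carrier A → CommutativeRing.Carrier B)
                  (φ-hom : RingMorphisms.IsRingHomomorphism
                             (CommutativeRing.rawRing A) (CommutativeRing.rawRing B) φ)
                  (α : CommutativeRing.Carrier B) where
  private
    module A = CommutativeRing A
  open CommutativeRing B
  open RingMorphisms.IsRingHomomorphism φ-hom
  open PolynomialRing A
  open RingProperties ring using (-0#≈0#)
  open IntegerSolver B
  open SetoidReasoning setoid
  open Exp semiring using () renaming (_^_ to _^ᴮ_)

  ev : Poly → Carrier
  ev p = evalAt A B φ p α

  private
    ev-[] : ∀ p → p ≋ [] → ev p ≈ 0#
    ev-[] []      e = refl
    ev-[] (c ∷ p) e = begin
      φ c + α * ev p  ≈⟨ +-cong (⟦⟧-cong (≋⇒≈ e ℕ.zero)) (*-congˡ (ev-[] p (≈⇒≋ (≋⇒≈ e ∘ ℕ.suc)))) ⟩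
      φ A.0# + α * 0# ≈⟨ +-cong 0#-homo (zeroʳ α) ⟩
      0# + 0#         ≈⟨ +-identityʳ 0# ⟩
      0#              ∎

  ev-cong : ∀ p q → p ≋ q → ev p ≈ ev q
  ev-cong []      q       e = sym (ev-[] q (≋-sym e))
  ev-cong (c ∷ p) []      e = ev-[] (c ∷ p) e
  ev-cong (c ∷ p) (d ∷ q) e =
    +-cong (⟦⟧-cong (≋⇒≈ e ℕ.zero)) (*-congˡ (ev-cong p q (≈⇒≋ (≋⇒≈ e ∘ ℕ.suc))))

  ev-+ : ∀ p q → ev (p +ₚ q) ≈ ev p + ev q
  ev-+ []      q       = sym (+-identityˡ _)
  ev-+ (c ∷ p) []      = sym (+-identityʳ _)
  ev-+ (c ∷ p) (d ∷ q) = begin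
    φ (c A.+ d) + α * ev (p +ₚ q)        ≈⟨ +-cong (+-homo c d) (*-congˡ (ev-+ p q)) ⟩
    (φ c + φ d) + α * (ev p + ev q)
      ≈⟨ solve 5 (λ c d a p q → (c :+ d) :+ a :* (p :+ q) := (c :+ a :* p) :+ (d :+ a :* q)) refl
           (φ c) (φ d) α (ev p) (ev q) ⟩
    (φ c + α * ev p) + (φ d + α * ev q)  ∎

  ev-scale : ∀ c p → ev (scale c p) ≈ φ c * ev p
  ev-scale c []      = sym (zeroʳ _)
  ev-scale c (d ∷ p) = begin
    φ (c A.* d) + α * ev (scale c p)  ≈⟨ +-cong (*-homo c d) (*-congˡ (ev-scale c p)) ⟩
    φ c * φ d + α * (φ c * ev p)
      ≈⟨ solve 4 (λ c d a p → c :* d :+ a :* (c :* p) := c :* (d :+ a :* p)) refl (φ c) (φ d) α (ev p) ⟩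
    φ c * (φ d + α * ev p)            ∎

  ev-* : ∀ p q → ev (p *ₚ q) ≈ ev p * ev q
  ev-* []      q = sym (zeroˡ _)
  ev-* (c ∷ p) q = begin
    ev (scale c q +ₚ (A.0# ∷ (p *ₚ q)))           ≈⟨ ev-+ (scale c q) (A.0# ∷ (p *ₚ q)) ⟩
    ev (scale c q) + (φ A.0# + α * ev (p *ₚ q))   ≈⟨ +-cong (ev-scale c q) (+-cong 0#-homo (*-congˡ (ev-* p q))) ⟩
    φ c * ev q + (0# + α * (ev p * ev q))
      ≈⟨ solve 4 (λ c a p q → c :* q :+ (:0 :+ a :* (p :* q)) := (c :+ a :* p) :* q) refl (φ c) α (ev p) (ev q) ⟩
    (φ c + α * ev p) * ev q                       ∎

  ev-neg : ∀ p → ev (-ₚ p) ≈ - ev p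
  ev-neg []      = sym -0#≈0#
  ev-neg (c ∷ p) = begin
    φ (A.- c) + α * ev (-ₚ p)  ≈⟨ +-cong (-‿homo c) (*-congˡ (ev-neg p)) ⟩
    - φ c + α * - ev p
      ≈⟨ solve 3 (λ c a p → :- c :+ a :* :- p := :- (c :+ a :* p)) refl (φ c) α (ev p) ⟩
    - (φ c + α * ev p)         ∎

  ev-const : ∀ c → ev (const c) ≈ φ c
  ev-const c = trans (+-congˡ (zeroʳ α)) (+-identityʳ _)

  ev-1 : ev (const A.1#) ≈ 1#
  ev-1 = trans (ev-const A.1#) 1#-homo

  ev-X : ev X ≈ α
  ev-X = begin
    φ A.0# + α * ev (const A.1#) ≈⟨ +-cong 0#-homo (*-congˡ ev-1) ⟩
    0# + α * 1#                  ≈⟨ trans (+-identityˡ _) (*-identityʳ α) ⟩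
    α                            ∎

  ev-X^ : ∀ n → ev (X ^ n) ≈ α ^ᴮ n
  ev-X^ zero      = ev-1
  ev-X^ (ℕ.suc n) = trans (ev-* X (X ^ n)) (*-cong ev-X (ev-X^ n))

module MapPolynomial (A B : CommutativeRing ℓ ℓ)
                     (φ : CommutativeRing.Carrier A → CommutativeRing.Carrier B)
                     (φ-hom : RingMorphisms.IsRingHomomorphism
                                (CommutativeRing.rawRing A) (CommutativeRing.rawRing B) φ) where
  private
    module A = CommutativeRing A
    module PA = PolynomialRing A
  open CommutativeRing B
  open RingMorphisms.IsRingHomomorphism φ-hom
  open PolynomialRing B
  private module P = CommutativeRing polyRing

  coeff-map : ∀ p i → coeff (map φ p) i ≈ φ (PA.coeff p i)
  coeff-map []      i         = sym 0#-homo
  coeff-map (c ∷ p) zero      = refl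
  coeff-map (c ∷ p) (ℕ.suc i) = coeff-map p i

  map-+ : ∀ p q → map φ (p PA.+ₚ q) ≋ map φ p +ₚ map φ q
  map-+ p q = ≈⇒≋ λ i → trans (coeff-map (p PA.+ₚ q) i)
    (trans (⟦⟧-cong (PA.coeff-+ p q i)) (trans (+-homo _ _)
      (sym (trans (coeff-+ (map φ p) (map φ q) i) (+-cong (coeff-map p i) (coeff-map q i))))))

  map-scale : ∀ c p → map φ (PA.scale c p) ≋ scale (φ c) (map φ p)
  map-scale c p = ≈⇒≋ λ i → trans (coeff-map (PA.scale c p) i)
    (trans (⟦⟧-cong (PA.coeff-scale c p i)) (trans (*-homo _ _)
      (sym (trans (coeff-scale (φ c) (map φ p) i) (*-congˡ (coeff-map p i))))))

  map-* : ∀ p q → map φ (p PA.*ₚ q) ≋ map φ p *ₚ map φ q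
  map-* []      q = P.refl
  map-* (c ∷ p) q = P.trans (map-+ (PA.scale c q) (A.0# ∷ (p PA.*ₚ q)))
    (P.+-cong (map-scale c q) (0#-homo ∷-cong map-* p q))

  map-X^ : ∀ n → map φ (PA.X PA.^ n) ≋ X ^ n
  map-X^ zero      = const-cong 1#-homo
  map-X^ (ℕ.suc n) = P.trans (map-* PA.X (PA.X PA.^ n))
    (P.*-cong {map φ PA.X} {X} (0#-homo ∷-cong 1#-homo ∷-cong P.refl) (map-X^ n))

-- Domains, Noetherian rings and maximal annihilators

_⊑_ : {A : Set ℓ} → Pred A ℓ → Pred A ℓ → Set ℓ
I ⊑ J = ∀ x → I x → J x

by-contradiction : ExcludedMiddle ℓ → {A : Set ℓ} → ¬ ¬ A → A
by-contradiction em {A} ¬¬a with em {A}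
... | yes a = a
... | no ¬a = ⊥-elim (¬¬a ¬a)

field⇒domain : ExcludedMiddle ℓ → (F : CommutativeRing ℓ ℓ) → IsField F → IsDomain F
field⇒domain em F F-field = record { 0≉1 = 0≉1 ; noZeroDivisors = nzd }
  where
  open CommutativeRing F
  open IsField F-field
  nzd : ∀ x y → x * y ≈ 0# → x ≈ 0# ⊎ y ≈ 0#
  nzd x y xy≈0 with em {x ≈ 0#}
  ... | yes x≈0 = inj₁ x≈0
  ... | no x≉0 =
    let (z , xz≈1) = inverse x x≉0 in
    inj₂ (trans (sym (*-identityˡ y)) (trans (*-congʳ (sym xz≈1))
      (trans (IntegerSolver.solve F 3 (λ x y z → (x S.:* z) S.:* y S.:= z S.:* (x S.:* y)) refl x y z)
        (trans (*-congˡ xy≈0) (zeroʳ z)))))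
    where module S = IntegerSolver F

module Domain (R : CommutativeRing ℓ ℓ) (R-domain : IsDomain R) where
  open CommutativeRing R
  open IsDomain R-domain
  open RingProperties ring

  *-≉0 : ∀ {x y} → ¬ x ≈ 0# → ¬ y ≈ 0# → ¬ x * y ≈ 0#
  *-≉0 {x} {y} x≉0 y≉0 e = Sum.[ x≉0 , y≉0 ]′ (noZeroDivisors x y e)

  *-≈0ʳ : ∀ {x y} → ¬ x ≈ 0# → x * y ≈ 0# → y ≈ 0#
  *-≈0ʳ {x} {y} x≉0 e with noZeroDivisors x y e
  ... | inj₁ x≈0 = ⊥-elim (x≉0 x≈0)
  ... | inj₂ y≈0 = y≈0

  *-cancel : ∀ {x} → ¬ x ≈ 0# → ∀ {y z} → x * y ≈ x * z → y ≈ z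
  *-cancel {x} x≉0 {y} {z} e = x∙y⁻¹≈ε⇒x≈y y z (*-≈0ʳ x≉0
    (trans (IntegerSolver.solve R 3 (λ x y z → x S.:* (y S.:- z) S.:= x S.:* y S.:- x S.:* z) refl x y z)
      (x≈y⇒x∙y⁻¹≈ε e)))
    where module S = IntegerSolver R

module Noetherian (R : CommutativeRing ℓ ℓ) (R-noetherian : IsNoetherian R) where
  open CommutativeRing R

  -- The union is an ideal, and its finitely many generators all occur at one stage.
  chain-stabilises : (U : ℕ → Pred Carrier ℓ) → (∀ n → IsIdeal R (U n)) →
                     (∀ n → U n ⊆ U (ℕ.suc n)) → ∃ λ N → ∀ m → U m ⊆ U N
  chain-stabilises U U-ideal step = N , λ m Um → generated⊆ (proj₁ (proj₂ fg) (m , Um))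
    where
    mono′ : ∀ {m n} → m ℕ.≤′ n → U m ⊆ U n
    mono′ (ℕ.≤′-reflexive ≡.refl) Um = Um
    mono′ (ℕ.≤′-step l)           Um = step _ (mono′ l Um)

    mono : ∀ {m n} → m ≤ n → U m ⊆ U n
    mono l = mono′ (ℕ.≤⇒≤′ l)

    ⋃U : Pred Carrier ℓ
    ⋃U x = ∃ λ n → U n x

    fg = R-noetherian ⋃U (record
      { resp     = λ { e (n , Ux) → n , IsIdeal.resp (U-ideal n) e Ux }
      ; 0∈       = 0 , IsIdeal.0∈ (U-ideal 0)
      ; +-closed = λ { (m , Ux) (n , Uy) → m ℕ.+ n , IsIdeal.+-closed (U-ideal (m ℕ.+ n))
                         (mono (ℕ.m≤m+n m n) Ux) (mono (ℕ.m≤n+m n m) Uy) }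
      ; *-closed = λ { r (n , Ux) → n , IsIdeal.*-closed (U-ideal n) r Ux }
      })

    module M = SetoidMembership setoid

    bound : ∀ xs → (∀ {x} → x M.∈ xs → ⋃U x) → ∃ λ N → ∀ {x} → x M.∈ xs → U N x
    bound []       _  = 0 , λ ()
    bound (x ∷ xs) xs⊆ =
      let (m , Ux)  = xs⊆ (here refl)
          (N , Uxs) = bound xs (xs⊆ ∘ there)
      in m ℕ.+ N , λ { (here y≈x) → mono (ℕ.m≤m+n m N) (IsIdeal.resp (U-ideal m) (sym y≈x) Ux)
                     ; (there y∈) → mono (ℕ.m≤n+m N m) (Uxs y∈) }

    bounded = bound (proj₁ fg) (λ x∈ → proj₂ (proj₂ fg) (gen x∈))
    N = proj₁ bounded

    generated⊆ : Generated R (M._∈ proj₁ fg) ⊆ U N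
    generated⊆ (gen x∈)             = proj₂ bounded x∈
    generated⊆ (Generated.resp e x) = IsIdeal.resp (U-ideal N) e (generated⊆ x)
    generated⊆ Generated.0∈         = IsIdeal.0∈ (U-ideal N)
    generated⊆ (Generated.+-closed x y) = IsIdeal.+-closed (U-ideal N) (generated⊆ x) (generated⊆ y)
    generated⊆ (Generated.*-closed r x) = IsIdeal.*-closed (U-ideal N) r (generated⊆ x)

  -- Otherwise every member has a strictly larger one, and iterating gives a chain that never
  -- stabilises.
  maximal-member : ExcludedMiddle ℓ → {X : Set ℓ} (I : X → Pred Carrier ℓ) → (∀ x → IsIdeal R (I x)) →
                   (C : Pred X ℓ) → ∀ {x} → C x →
                   ∃ λ m → C m ∧ (∀ y → C y → I m ⊑ I y → I y ⊑ I m)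
  maximal-member em {X} I I-ideal C {x₀} Cx₀ = by-contradiction em λ none →
    let open Ascent none
        (N , stable) = chain-stabilises (λ n → I (proj₁ (seq n))) (λ n → I-ideal (proj₁ (seq n)))
                         (λ n {x} → proj₁ (proj₂ (proj₂ (larger (seq n)))) x)
    in proj₂ (proj₂ (proj₂ (larger (seq N)))) (λ x → stable (ℕ.suc N) {x})
    where
    module Ascent (none : ¬ (∃ λ m → C m ∧ (∀ y → C y → I m ⊑ I y → I y ⊑ I m))) where
      larger : (m : ∃ C) → ∃ λ y → C y ∧ I (proj₁ m) ⊑ I y ∧ ¬ (I y ⊑ I (proj₁ m))
      larger (m , Cm) = by-contradiction em λ no-larger →
        none (m , Cm , λ y Cy Im⊆Iy → by-contradiction em λ ⊈ → no-larger (y , Cy , Im⊆Iy , ⊈))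

      seq : ℕ → ∃ C
      seq zero      = x₀ , Cx₀
      seq (ℕ.suc n) = proj₁ (larger (seq n)) , proj₁ (proj₂ (larger (seq n)))

  -- I x plays the role of the annihilator of x in a module; a maximal one among
  -- those disjoint from the multiplicative set S is prime.
  module MaximalAnnihilator
    (em : ExcludedMiddle ℓ) {X : Set ℓ} (_•_ : Carrier → X → X)
    (I : X → Pred Carrier ℓ) (I-ideal : ∀ x → IsIdeal R (I x))
    (•⇒ : ∀ r x {s} → I (r • x) s → I x (s * r))
    (⇒• : ∀ r x {s} → I x (s * r) → I (r • x) s)
    (S : Pred Carrier ℓ) (1∈S : S 1#) (*∈S : ∀ {s t} → S s → S t → S (s * t))
    (C : Pred X ℓ) (•∈C : ∀ r {x} → C x → C (r • x)) where

    Disjoint : Pred X ℓ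
    Disjoint x = ∀ {s} → S s → ¬ I x s

    record Maximal : Set ℓ where
      field
        element  : X
        ∈C       : C element
        disjoint : Disjoint element
        isPrime  : IsPrimeIdeal R (I element)
        maximal  : ∀ y → C y → Disjoint y → I element ⊑ I y → I y ⊑ I element

    maximal-annihilator : ∀ {x} → C x → Disjoint x → Maximal
    maximal-annihilator Cx₀ Dx₀ = record
      { element = m ; ∈C = Cm ; disjoint = Dm ; maximal = λ y Cy Dy → max y (Cy , Dy)
      ; isPrime = record { isIdeal = I-ideal m ; 1∉ = Dm 1∈S ; prime = prime } }
      where
      found = maximal-member em I I-ideal (λ x → C x ∧ Disjoint x) (Cx₀ , λ {s} → Dx₀ {s})
      m = proj₁ found
      Cm = proj₁ (proj₁ (proj₂ found))
      Dm : Disjoint m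
      Dm = proj₂ (proj₁ (proj₂ found))
      max = proj₂ (proj₂ found)
      open IdealProperties R (I m) (I-ideal m)

      prime : ∀ x y → I m (x * y) → I m x ⊎ I m y
      -- If x ∉ I m, then x • m is admissible and I m ⊆ I (x • m), so maximality gives equality; and
      -- y ∈ I (x • m) because x y ∈ I m.
      prime x y xy = by-contradiction em λ neither →
        neither (inj₂ (max (x • m) (•∈C x Cm , Dxm (neither ∘ inj₁))
          (λ s Is → ⇒• x m (*-closedʳ x Is)) y (⇒• x m (resp (*-comm x y) xy))))
        where
        Dxm : ¬ I m x → Disjoint (x • m)
        -- If d ∈ S annihilates x • m, then x annihilates d • m, which is admissible because S is
        -- multiplicative; maximality puts x into I m.
        Dxm ¬Ix {d} Sd Id = ¬Ix (max (d • m) (•∈C d Cm , λ {e} Se Ie → Dm (*∈S Se Sd) (•⇒ d m Ie))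
          (λ s Is → ⇒• d m (*-closedʳ d Is)) x (⇒• d m (resp (*-comm d x) (•⇒ x m Id))))

-- Dedekind rings: almost integral fractions, primes and uniformizers

module Dedekind {ℓ : Level} (em : ExcludedMiddle ℓ) (R K : CommutativeRing ℓ ℓ)
                (ι : CommutativeRing.Carrier R → CommutativeRing.Carrier K)
                (dedekind : IsDedekindWithQuotientField R K ι) where
  open IsDedekindWithQuotientField dedekind
  open IsQuotientField isQuotientField
  private
    module K = CommutativeRing K
    module KE = Exp K.semiring
    module KP = Polynomial K
  open CommutativeRing R
  open PolynomialRing R
  open Noetherian R isNoetherian
  ι-hom = RingMorphisms.IsRingMonomorphism.isRingHomomorphism isEmbedding
  open RingMorphisms.IsRingMonomorphism isEmbedding
  module RDom = Domain R isDomain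
  K-domain : IsDomain K
  K-domain = field⇒domain em K isField
  module KDom = Domain K K-domain

  ι≉0 : ∀ {r} → ¬ r ≈ 0# → ¬ ι r K.≈ K.0#
  ι≉0 r≉0 e = r≉0 (injective (K.trans e (K.sym 0#-homo)))

  private
    -- In `IsIntegralOver` the length of the coefficient list is the degree of the equation, so a
    -- shorter list has to be filled with zeros to length exactly N.
    pad : ℕ → KP.Poly → KP.Poly
    pad zero      _       = []
    pad (ℕ.suc N) []      = K.0# ∷ pad N []
    pad (ℕ.suc N) (c ∷ p) = c ∷ pad N p

    length-pad : ∀ N p → length (pad N p) ≡ N
    length-pad zero      _       = ≡.refl
    length-pad (ℕ.suc N) []      = ≡.cong ℕ.suc (length-pad N [])
    length-pad (ℕ.suc N) (c ∷ p) = ≡.cong ℕ.suc (length-pad N p)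

    eval-pad : ∀ N p x → length p ≤ N → KP.eval (pad N p) x K.≈ KP.eval p x
    eval-pad zero      []      x _       = K.refl
    eval-pad (ℕ.suc N) []      x _       = K.trans (K.+-identityˡ _)
      (K.trans (K.*-congˡ (eval-pad N [] x z≤n)) (K.zeroʳ x))
    eval-pad (ℕ.suc N) (c ∷ p) x (s≤s l) = K.+-congˡ (K.*-congˡ (eval-pad N p x l))

    All-pad : ∀ N p → All (Image R K ι) (pad N (map ι p))
    All-pad zero      _       = []
    All-pad (ℕ.suc N) []      = (0# , K.sym 0#-homo) ∷ All-pad N []
    All-pad (ℕ.suc N) (c ∷ p) = (c , K.refl) ∷ All-pad N p

  -- The ideals {r : r = d p(κ), deg p < N} stabilise, so κ is integral over R.
  almost-integral : ∀ κ d → ¬ d ≈ 0# → (∀ k → ∃ λ r → ι r K.≈ ι d K.* κ KE.^ k) →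
                    ∃ λ r → κ K.≈ ι r
  almost-integral κ d d≉0 powers = integrallyClosed κ tt (pad N (map ι (-ₚ p)) , All-pad N (-ₚ p) , (begin
    κ KE.^ length (pad N (map ι (-ₚ p))) K.+ KP.eval (pad N (map ι (-ₚ p))) κ
      ≈⟨ K.+-cong (K.reflexive (≡.cong (κ KE.^_) (length-pad N (map ι (-ₚ p)))))
           (eval-pad N (map ι (-ₚ p)) κ (≡.subst (_≤ N) (≡.sym (length-map ι (-ₚ p))) (length--ₚ p lp))) ⟩
    κ KE.^ N K.+ ev (-ₚ p) ≈⟨ K.+-cong κ^N≈ (ev-neg p) ⟩
    ev p K.- ev p          ≈⟨ K.-‿inverseʳ (ev p) ⟩
    K.0#                   ∎))
    where
    open Evaluation R K ι ι-hom κ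
    open SetoidReasoning K.setoid
    module KS = IntegerSolver K
    U : ℕ → Pred Carrier ℓ
    U N r = ∃ λ p → length p ≤ N ∧ ι r K.≈ ι d K.* ev p

    U-ideal : ∀ N → IsIdeal R (U N)
    U-ideal N = record
      { resp     = λ { e (p , l , eq) → p , l , K.trans (⟦⟧-cong (sym e)) eq }
      ; 0∈       = [] , z≤n , K.trans 0#-homo (K.sym (K.zeroʳ _))
      ; +-closed = λ { {x} {y} (p , l , eq) (q , l′ , eq′) → p +ₚ q , length-+ₚ p q l l′ ,
                     K.trans (+-homo x y) (K.trans (K.+-cong eq eq′)
                       (K.trans (K.sym (K.distribˡ _ _ _)) (K.*-congˡ (K.sym (ev-+ p q))))) }
      ; *-closed = λ { r {x} (p , l , eq) → scale r p , ≡.subst (_≤ N) (≡.sym (length-map (r *_) p)) l ,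
                     K.trans (*-homo r x) (K.trans (K.*-congˡ eq)
                       (K.trans (KS.solve 3 (λ r d p → r KS.:* (d KS.:* p) KS.:= d KS.:* (r KS.:* p))
                                   K.refl (ι r) (ι d) (ev p))
                         (K.*-congˡ (K.sym (ev-scale r p))))) }
      }

    stable = chain-stabilises U U-ideal (λ { n (p , l , eq) → p , ℕ.m≤n⇒m≤1+n l , eq })
    N = proj₁ stable
    r = proj₁ (powers N)
    -- d κᴺ belongs to stage N + 1, hence to stage N; cancelling d writes κᴺ as p(κ) with p of
    -- degree below N.
    in-U = proj₂ stable (ℕ.suc N) {r} (X ^ N , length-X^ N ,
             K.trans (proj₂ (powers N)) (K.*-congˡ (K.sym (ev-X^ N))))
    p = proj₁ in-U
    lp = proj₁ (proj₂ in-U)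
    κ^N≈ : κ KE.^ N K.≈ ev p
    κ^N≈ = KDom.*-cancel (ι≉0 d≉0) (K.trans (K.sym (proj₂ (powers N))) (proj₂ (proj₂ in-U)))

  -- The elements d (s/t)^k all lie in Q ⊆ R, so s/t is almost integral.
  stable-quotient : ∀ {s t} → ¬ t ≈ 0# → (Q : Pred Carrier ℓ) → ∀ {d} → ¬ d ≈ 0# → Q d →
                    (∀ {x} → Q x → ∃ λ y → Q y ∧ s * x ≈ t * y) → ∃ λ z → s ≈ t * z
  stable-quotient {s} {t} t≉0 Q {d} d≉0 Qd stable =
    let (z , q≈z) = almost-integral q d d≉0 (λ k → let (y , _ , eq) = powers k in y , eq) in
    z , injective (K.trans (K.sym (K.*-identityʳ _)) (K.trans (K.*-congˡ (K.sym tt⁻¹))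
          (K.trans (KS.solve 3 (λ s t i → s KS.:* (t KS.:* i) KS.:= t KS.:* (s KS.:* i)) K.refl (ι s) (ι t) t⁻¹)
            (K.trans (K.*-congˡ q≈z) (K.sym (*-homo t z))))))
    where
    module KS = IntegerSolver K
    t⁻¹ = proj₁ (IsField.inverse isField (ι t) (ι≉0 t≉0))
    tt⁻¹ = proj₂ (IsField.inverse isField (ι t) (ι≉0 t≉0))
    q = ι s K.* t⁻¹

    *q : ∀ {x y} → s * x ≈ t * y → ι x K.* q K.≈ ι y
    *q {x} {y} eq = KDom.*-cancel (ι≉0 t≉0) (begin
      ι t K.* (ι x K.* q)
        ≈⟨ KS.solve 4 (λ t x s i → t KS.:* (x KS.:* (s KS.:* i)) KS.:= (t KS.:* i) KS.:* (s KS.:* x))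
             K.refl (ι t) (ι x) (ι s) t⁻¹ ⟩
      (ι t K.* t⁻¹) K.* (ι s K.* ι x)   ≈⟨ K.*-cong tt⁻¹ (K.sym (*-homo s x)) ⟩
      K.1# K.* ι (s * x)                ≈⟨ K.*-identityˡ _ ⟩
      ι (s * x)                         ≈⟨ ⟦⟧-cong eq ⟩
      ι (t * y)                         ≈⟨ *-homo t y ⟩
      ι t K.* ι y                       ∎)
      where open SetoidReasoning K.setoid

    powers : ∀ k → ∃ λ y → Q y ∧ ι y K.≈ ι d K.* q KE.^ k
    powers zero = d , Qd , K.sym (K.*-identityʳ _)
    powers (ℕ.suc k) =
      let (x , Qx , eq) = powers k
          (y , Qy , eq′) = stable Qx
      in y , Qy , K.trans (K.sym (*q eq′)) (K.trans (K.*-congʳ eq)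
           (KS.solve 3 (λ d k q → d KS.:* k KS.:* q KS.:= d KS.:* (q KS.:* k)) K.refl (ι d) (q KE.^ k) q))

  NonZeroIdeal : Pred Carrier ℓ → Set ℓ
  NonZeroIdeal P = ∃ λ x → P x ∧ ¬ x ≈ 0#

  module _ {P : Pred Carrier ℓ} (P-prime : IsPrimeIdeal R P) (P≉0 : NonZeroIdeal P) where
    open IsPrimeIdeal P-prime
    open IdealProperties R P isIdeal
    private module S = IntegerSolver R

    -- Maximality of P, applied to the ideal c R + P.
    inverse-mod : ∀ c → ¬ P c → ∃ λ c′ → ∃ λ x → P x ∧ c′ * c + x ≈ 1#
    inverse-mod c ¬Pc with IsMaximalIdeal.maximal (primesMaximal P P-prime P≉0) J J-ideal P⊆J
      where
      J : Pred Carrier ℓ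
      J y = ∃ λ c′ → ∃ λ x → P x ∧ c′ * c + x ≈ y
      J-ideal : IsIdeal R J
      J-ideal = record
        { resp     = λ { e (c′ , x , Px , eq) → c′ , x , Px , trans eq e }
        ; 0∈       = 0# , 0# , 0∈ , trans (+-identityʳ _) (zeroˡ c)
        ; +-closed = λ { (c′ , x , Px , eq) (c″ , y , Py , eq′) → c′ + c″ , x + y , +-closed Px Py ,
            trans (S.solve 5 (λ a b c x y → (a S.:+ b) S.:* c S.:+ (x S.:+ y) S.:=
                     (a S.:* c S.:+ x) S.:+ (b S.:* c S.:+ y)) refl c′ c″ c x y) (+-cong eq eq′) }
        ; *-closed = λ { r (c′ , x , Px , eq) → r * c′ , r * x , *-closed r Px ,
            trans (S.solve 4 (λ r a c x → (r S.:* a) S.:* c S.:+ r S.:* x S.:=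
                     r S.:* (a S.:* c S.:+ x)) refl r c′ c x) (*-congˡ eq) }
        }
      P⊆J : P ⊆ J
      P⊆J {x} Px = 0# , x , Px , trans (+-congʳ (zeroˡ c)) (+-identityˡ x)
    ... | inj₁ J⊆P = ⊥-elim (¬Pc (J⊆P (1# , 0# , 0∈ , trans (+-identityʳ _) (*-identityˡ c))))
    ... | inj₂ 1∈J = 1∈J

    -- P is principal after inverting c.
    record Uniformizer : Set ℓ where
      field
        π c     : Carrier
        π∈P     : P π
        c∉P     : ¬ P c
        π≉0     : ¬ π ≈ 0#
        divides : ∀ {x} → P x → ∃ λ x′ → c * x ≈ π * x′

      -- In other words c/π ∉ R, which contradicts the conclusion of `stable-quotient` for s = c and
      -- t = π.
      π∤c : ¬ (∃ λ z → c ≈ π * z)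
      π∤c (z , c≈πz) = c∉P (resp (sym c≈πz) (*-closedʳ z π∈P))

    -- With t ∈ P nonzero, P = (tR : s) for some s.  If s/t maps P into P then it is
    -- integral over R, which is impossible; otherwise s/t takes some π ∈ P outside P.
    uniformizer : Uniformizer
    uniformizer = by-contradiction em λ none → Dm {1#} 1∉ (one∈ none)
      where
      t = proj₁ P≉0
      Pt = proj₁ (proj₂ P≉0)
      t≉0 = proj₂ (proj₂ P≉0)

      I : Carrier → Pred Carrier ℓ
      I s r = ∃ λ x → r * s ≈ t * x

      I-ideal : ∀ s → IsIdeal R (I s)
      I-ideal s = record
        { resp     = λ { e (x , eq) → x , trans (*-congʳ (sym e)) eq }
        ; 0∈       = 0# , trans (zeroˡ s) (sym (zeroʳ t))
        ; +-closed = λ { (x , eq) (y , eq′) → x + y , trans (distribʳ s _ _)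
                       (trans (+-cong eq eq′) (sym (distribˡ t x y))) }
        ; *-closed = λ { r (x , eq) → r * x , trans (*-assoc r _ s) (trans (*-congˡ eq)
                       (S.solve 3 (λ r t x → r S.:* (t S.:* x) S.:= t S.:* (r S.:* x)) refl r t x)) }
        }

      *∉P : ∀ {x y} → ¬ P x → ¬ P y → ¬ P (x * y)
      *∉P ¬Px ¬Py Pxy = Sum.[ ¬Px , ¬Py ]′ (prime _ _ Pxy)

      open MaximalAnnihilator em _*_ I I-ideal
        (λ r x {s} (y , eq) → y , trans (*-assoc s r x) eq)
        (λ r x {s} (y , eq) → y , trans (sym (*-assoc s r x)) eq)
        (λ x → ¬ P x) 1∉ *∉P (λ _ → ⊤) (λ _ _ → tt)

      -- I 1 = t R lies inside P, so it misses the complement of P. A maximal annihilator I s of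
      -- this kind is a prime inside P that contains t ≠ 0; it is then a maximal ideal, hence equal
      -- to P.
      M : Maximal
      M = maximal-annihilator {1#} tt (λ ¬Px (y , eq) → ¬Px
            (resp (sym (trans (sym (*-identityʳ _)) eq)) (*-closedʳ y Pt)))
      s = Maximal.element M
      Dm : Disjoint s
      Dm = Maximal.disjoint M

      I⊆P : I s ⊆ P
      I⊆P Ix = by-contradiction em λ ¬Px → Dm ¬Px Ix

      P⊆I : P ⊆ I s
      P⊆I {x} Px = Sum.[ (λ P⊆Is → P⊆Is Px) , (λ 1∈P → ⊥-elim (1∉ 1∈P)) ]′
        (IsMaximalIdeal.maximal (primesMaximal (I s) (Maximal.isPrime M) (t , (s , refl) , t≉0)) P isIdeal I⊆P)

      module _ (none : ¬ Uniformizer) where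
        -- If x ∈ P and s x = t y with y ∉ P, then π = x and c = y form a uniformizer, because s z =
        -- t z′ gives y z = x z′ for every z ∈ P. Without one, s/t therefore maps P into P.
        into-P : ∀ {x} → P x → ∃ λ y → P y ∧ s * x ≈ t * y
        into-P {x} Px = let (y , eq) = P⊆I Px in y , by-contradiction em (λ ¬Py → none (record
          { π = x ; c = y ; π∈P = Px ; c∉P = ¬Py
          ; π≉0 = λ x≈0 → ¬Py (resp (sym (RDom.*-≈0ʳ t≉0 (trans (sym eq) (trans (*-congʳ x≈0) (zeroˡ s))))) 0∈)
          ; divides = λ {z} Pz → let (z′ , eq′) = P⊆I Pz in z′ , RDom.*-cancel t≉0
              (trans (sym (*-assoc t y z)) (trans (*-congʳ (sym eq))
                (trans (S.solve 3 (λ x s z → x S.:* s S.:* z S.:= x S.:* (z S.:* s)) refl x s z)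
                  (trans (*-congˡ eq′) (S.solve 3 (λ x t z → x S.:* (t S.:* z) S.:= t S.:* (x S.:* z)) refl x t z′)))))
          })) , trans (*-comm s x) eq

        one∈ : I s 1#
        -- Now s/t is integral over R, so s ∈ t R. This means 1 ∈ I s, although I s avoids
        -- everything outside P.
        one∈ = let (z , s≈) = stable-quotient t≉0 P t≉0 Pt into-P in z , trans (*-identityˡ s) s≈

  -- An associated prime of R/J: the annihilators are I u = (J : u), and S = {1} only excludes the
  -- unit ideal.
  prime-above : (J : Pred Carrier ℓ) → IsIdeal R J → ¬ J 1# → ∃ λ P → IsPrimeIdeal R P ∧ J ⊆ P
  prime-above J J-ideal 1∉J =
    I (Maximal.element M) , Maximal.isPrime M , λ {x} Jx → *-closedʳ (Maximal.element M) Jx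
    where
    open IdealProperties R J J-ideal
    I : Carrier → Pred Carrier ℓ
    I u r = J (r * u)
    I-ideal : ∀ u → IsIdeal R (I u)
    I-ideal u = record
      { resp     = λ e → resp (*-congʳ e)
      ; 0∈       = resp (sym (zeroˡ u)) 0∈
      ; +-closed = λ Jx Jy → resp (sym (distribʳ u _ _)) (+-closed Jx Jy)
      ; *-closed = λ r Jx → resp (sym (*-assoc r _ u)) (*-closed r Jx)
      }
    open MaximalAnnihilator em _*_ I I-ideal
      (λ r x {s} → resp (sym (*-assoc s r x))) (λ r x {s} → resp (*-assoc s r x))
      (1# ≈_) refl (λ e e′ → trans (sym (*-identityˡ 1#)) (*-cong e e′)) (λ _ → ⊤) (λ _ _ → tt)
    M : Maximal
    M = maximal-annihilator {1#} tt (λ 1≈s Js → 1∉J (resp (trans (*-identityʳ _) (sym 1≈s)) Js))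

-- Gauss's lemma for monic factors over a Dedekind ring

module MonicFactor {ℓ : Level} (em : ExcludedMiddle ℓ) (R K : CommutativeRing ℓ ℓ)
                   (ι : CommutativeRing.Carrier R → CommutativeRing.Carrier K)
                   (dedekind : IsDedekindWithQuotientField R K ι) where
  open IsDedekindWithQuotientField dedekind
  open IsQuotientField isQuotientField
  open Dedekind em R K ι dedekind
  private
    module K = CommutativeRing K
    module KP = PolynomialRing K
    module KPR = CommutativeRing KP.polyRing
    module KS = IntegerSolver K
    module KPS = IntegerSolver KP.polyRing
  open CommutativeRing R
  open PolynomialRing R
  open RingMorphisms.IsRingMonomorphism isEmbedding
  open MapPolynomial R K ι ι-hom

  IsMultiple : KP.Poly → Carrier → Poly → Set ℓ
  IsMultiple g r p = ∀ i → ι (coeff p i) K.≈ ι r K.* KP.coeff g i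

  -- The inverse of the content of g, the fractional ideal generated by its coefficients.
  Denominator : KP.Poly → Pred Carrier ℓ
  Denominator g r = ∃ λ p → IsMultiple g r p

  Denominator-isIdeal : ∀ g → IsIdeal R (Denominator g)
  Denominator-isIdeal g = record
    { resp     = λ { e (p , eq) → p , λ i → K.trans (eq i) (K.*-congʳ (⟦⟧-cong e)) }
    ; 0∈       = [] , λ i → K.trans 0#-homo (K.sym (K.trans (K.*-congʳ 0#-homo) (K.zeroˡ _)))
    ; +-closed = λ { {x} {y} (p , eq) (q , eq′) → p +ₚ q , λ i →
        K.trans (⟦⟧-cong (coeff-+ p q i)) (K.trans (+-homo _ _) (K.trans (K.+-cong (eq i) (eq′ i))
          (K.trans (K.sym (K.distribʳ _ _ _)) (K.*-congʳ (K.sym (+-homo x y)))))) }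
    ; *-closed = λ { r {x} (p , eq) → scale r p , λ i →
        K.trans (⟦⟧-cong (coeff-scale r p i)) (K.trans (*-homo _ _) (K.trans (K.*-congˡ (eq i))
          (K.trans (K.sym (K.*-assoc _ _ _)) (K.*-congʳ (K.sym (*-homo r x)))))) }
    }

  clear-denominators : ∀ g → ∃ λ d → ¬ d ≈ 0# ∧ Denominator g d
  clear-denominators [] = 1# , (λ e → IsDomain.0≉1 isDomain (sym e)) , [] ,
    λ i → K.trans 0#-homo (K.sym (K.zeroʳ _))
  clear-denominators (y ∷ g) =
    let (d , d≉0 , p , eq) = clear-denominators g
        (r , s , s≉0 , ys≈r) = fraction y
    in d * s , RDom.*-≉0 d≉0 s≉0 , (d * r) ∷ scale s p , λ
       { zero → K.trans (*-homo d r) (K.trans (K.*-congˡ (K.sym ys≈r))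
           (K.trans (KS.solve 3 (λ d y s → d KS.:* (y KS.:* s) KS.:= d KS.:* s KS.:* y) K.refl (ι d) y (ι s))
             (K.*-congʳ (K.sym (*-homo d s)))))
       ; (ℕ.suc i) → K.trans (⟦⟧-cong (coeff-scale s p i)) (K.trans (*-homo _ _) (K.trans (K.*-congˡ (eq i))
           (K.trans (KS.solve 3 (λ s d y → s KS.:* (d KS.:* y) KS.:= d KS.:* s KS.:* y) K.refl (ι s) (ι d) (KP.coeff g i))
             (K.*-congʳ (K.sym (*-homo d s))))))
       }

  module _ {P : Pred Carrier ℓ} (P-prime : IsPrimeIdeal R P) (P≉0 : NonZeroIdeal P) where
    open IsPrimeIdeal P-prime
    open CoefficientIdeal R P isIdeal

    module _ (U : Uniformizer P-prime P≉0) where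
      open Uniformizer U

      divide-coeffs : ∀ p → Coeffs p → ∃ λ p′ → ∀ i → c * coeff p i ≈ π * coeff p′ i
      divide-coeffs []      _  = [] , λ i → trans (zeroʳ c) (sym (zeroʳ π))
      divide-coeffs (x ∷ p) Pp =
        let (x′ , eq)  = divides (coeff∈ Pp 0)
            (p′ , eqs) = divide-coeffs p (Coeffs-tail Pp)
        in x′ ∷ p′ , λ { zero → eq ; (ℕ.suc i) → eqs i }

    -- Otherwise c/π would map the denominators of g into themselves.
    unit-content : ∀ e d → length d ≤ e →
                   ∃ λ r → ∃ λ p → IsMultiple (KP.monic e d) r p ∧ ¬ Coeffs p
    unit-content e d ld = by-contradiction em λ none →
      let (b , b≉0 , Db) = clear-denominators g
      in π∤c (stable-quotient π≉0 (Denominator g) b≉0 Db (step none))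
      where
      U = uniformizer P-prime P≉0
      open Uniformizer U
      g = KP.monic e d

      -- As g is monic of degree e, the multiplier r is itself the coefficient of x^e in r g.
      -- Multiplying r g by c/π thus multiplies r by c/π and keeps it in R.
      leading : ∀ {r} p → IsMultiple g r p → r ≈ coeff p e
      leading p eq = injective (K.sym (K.trans (eq e)
        (K.trans (K.*-congˡ (KP.coeff-monic e d ld)) (K.*-identityʳ _))))

      step : ¬ (∃ λ r → ∃ λ p → IsMultiple g r p ∧ ¬ Coeffs p) →
             ∀ {r} → Denominator g r → ∃ λ r′ → Denominator g r′ ∧ c * r ≈ π * r′
      step none {r} (p , eq) = r′ , (p′ , λ i → KDom.*-cancel (ι≉0 π≉0) (begin
          ι π K.* ι (coeff p′ i)                 ≈⟨ *-homo π _ ⟨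
          ι (π * coeff p′ i)                     ≈⟨ ⟦⟧-cong (eqs i) ⟨
          ι (c * coeff p i)                      ≈⟨ *-homo c _ ⟩
          ι c K.* ι (coeff p i)                  ≈⟨ K.*-congˡ (eq i) ⟩
          ι c K.* (ι r K.* KP.coeff g i)         ≈⟨ K.*-assoc _ _ _ ⟨
          ι c K.* ι r K.* KP.coeff g i           ≈⟨ K.*-congʳ (*-homo c r) ⟨
          ι (c * r) K.* KP.coeff g i             ≈⟨ K.*-congʳ (⟦⟧-cong cr≈) ⟩
          ι (π * r′) K.* KP.coeff g i            ≈⟨ K.*-congʳ (*-homo π r′) ⟩
          ι π K.* ι r′ K.* KP.coeff g i          ≈⟨ K.*-assoc _ _ _ ⟩
          ι π K.* (ι r′ K.* KP.coeff g i)        ∎)) , cr≈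
        where
        open SetoidReasoning K.setoid
        Pp : Coeffs p
        Pp = by-contradiction em λ ¬Pp → none (r , p , eq , ¬Pp)
        divided = divide-coeffs U p Pp
        p′ = proj₁ divided
        eqs = proj₂ divided
        r′ = coeff p′ e
        cr≈ : c * r ≈ π * r′
        cr≈ = trans (*-congˡ (leading p eq)) (eqs e)

  IsMultiple⇒≋ : ∀ {g r p} → IsMultiple g r p → map ι p KP.≋ KP.const (ι r) KP.*ₚ g
  IsMultiple⇒≋ {g} {r} {p} eq = KP.≈⇒≋ λ i →
    K.trans (coeff-map p i) (K.trans (eq i) (K.sym (KP.coeff-const* (ι r) g i)))

  -- Gauss's lemma: the contents of the two factors are invertible ideals whose
  -- product is contained in no prime.
  monic-factor : ∀ e d → length d ≤ e → ∀ k q → length q ≤ k → ∀ f →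
                 map ι f KP.≋ KP.monic e d KP.*ₚ KP.monic k q →
                 ∃ λ d′ → length d′ ≤ e ∧ map ι d′ KP.≋ d
  monic-factor e d ld k q lq f f≋ = d′ , ld′ , d′≋
    where
    g = KP.monic e d
    h = KP.monic k q

    1∈ : Denominator g 1#
    -- For a prime P above `Denominator g`, some r g and some s h have coefficients in R that are
    -- not all in P. Their product r s f has all its coefficients in P, because r ∈ `Denominator g`.
    1∈ = by-contradiction em λ 1∉ →
      let (P , P-prime , J⊆P) = prime-above (Denominator g) (Denominator-isIdeal g) 1∉
          open IsPrimeIdeal P-prime using (isIdeal; prime)
          open CoefficientIdeal R P isIdeal
          (b , b≉0 , Db) = clear-denominators g
          P≉0 = b , J⊆P Db , b≉0
          (r , p , eq , ¬Pp)    = unit-content P-prime P≉0 e d ld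
          (s , p′ , eq′ , ¬Pp′) = unit-content P-prime P≉0 k q lq
      in Sum.[ ¬Pp , ¬Pp′ ]′ (Coeffs-prime em prime p p′ (all∈ λ i →
           IsIdeal.resp isIdeal (sym (product r p s p′ eq eq′ i))
             (IdealProperties.*-closedʳ R P isIdeal (s * coeff f i) (J⊆P (p , eq)))))
      where
      product : ∀ r p s p′ → IsMultiple g r p → IsMultiple h s p′ →
                ∀ i → coeff (p *ₚ p′) i ≈ r * (s * coeff f i)
      product r p s p′ eq eq′ i = injective (begin
        ι (coeff (p *ₚ p′) i)                          ≈⟨ coeff-map (p *ₚ p′) i ⟨
        KP.coeff (map ι (p *ₚ p′)) i                   ≈⟨ KP.≋⇒≈ as-product i ⟩
        KP.coeff (KP.const (ι r) KP.*ₚ (KP.const (ι s) KP.*ₚ map ι f)) i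
          ≈⟨ K.trans (KP.coeff-const* (ι r) (KP.const (ι s) KP.*ₚ map ι f) i) (K.*-congˡ (KP.coeff-const* (ι s) (map ι f) i)) ⟩
        ι r K.* (ι s K.* KP.coeff (map ι f) i)         ≈⟨ K.*-congˡ (K.*-congˡ (coeff-map f i)) ⟩
        ι r K.* (ι s K.* ι (coeff f i))                ≈⟨ K.*-congˡ (*-homo s _) ⟨
        ι r K.* ι (s * coeff f i)                      ≈⟨ *-homo r _ ⟨
        ι (r * (s * coeff f i))                        ∎)
        where
        open SetoidReasoning K.setoid
        as-product : map ι (p *ₚ p′) KP.≋ KP.const (ι r) KP.*ₚ (KP.const (ι s) KP.*ₚ map ι f)
        as-product = KPR.trans (map-* p p′) (KPR.trans
          (KPR.*-cong {map ι p} {KP.const (ι r) KP.*ₚ g} {map ι p′} {KP.const (ι s) KP.*ₚ h}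
             (IsMultiple⇒≋ eq) (IsMultiple⇒≋ eq′))
          (KPR.trans
            (KPS.solve 4 (λ r g s h → (r KPS.:* g) KPS.:* (s KPS.:* h) KPS.:= r KPS.:* (s KPS.:* (g KPS.:* h)))
               KPR.refl (KP.const (ι r)) g (KP.const (ι s)) h)
            (KPR.*-congˡ {KP.const (ι r)} (KPR.*-congˡ {KP.const (ι s)} (KPR.sym f≋)))))

    integral-coeff : ∀ i → ∃ λ x → KP.coeff d i K.≈ ι x
    integral-coeff i = x , (begin
      KP.coeff d i
        ≈⟨ KS.solve 2 (λ x d → d KS.:= (x KS.:+ d) KS.:- x) K.refl (KP.coeff (KP.X KP.^ e) i) (KP.coeff d i) ⟩
      (KP.coeff (KP.X KP.^ e) i K.+ KP.coeff d i) K.- KP.coeff (KP.X KP.^ e) i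
        ≈⟨ K.+-congʳ (KP.coeff-+ (KP.X KP.^ e) d i) ⟨
      KP.coeff g i K.- KP.coeff (KP.X KP.^ e) i
        ≈⟨ K.+-cong (K.trans (K.sym (K.*-identityˡ _)) (K.trans (K.*-congʳ (K.sym 1#-homo)) (K.sym (proj₂ 1∈ i))))
                    (K.-‿cong (K.trans (K.sym (KP.≋⇒≈ (map-X^ e) i)) (coeff-map (X ^ e) i))) ⟩
      ι (coeff (proj₁ 1∈) i) K.- ι (coeff (X ^ e) i)
        ≈⟨ K.trans (+-homo _ _) (K.+-congˡ (-‿homo _)) ⟨
      ι x ∎)
      where
      open SetoidReasoning K.setoid
      x = coeff (proj₁ 1∈) i - coeff (X ^ e) i

    lift-poly : ∀ d → (∀ i → ∃ λ x → KP.coeff d i K.≈ ι x) → ∃ λ d′ → length d′ ≡ length d ∧ map ι d′ KP.≋ d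
    lift-poly []      _ = [] , ≡.refl , KPR.refl
    lift-poly (y ∷ d) xs =
      let (d′ , l , eq) = lift-poly d (xs ∘ ℕ.suc)
          (x , y≈) = xs 0
      in x ∷ d′ , ≡.cong ℕ.suc l , (K.sym y≈ KP.∷-cong eq)

    lifted = lift-poly d integral-coeff
    d′ = proj₁ lifted
    ld′ : length d′ ≤ e
    ld′ = ≡.subst (_≤ e) (≡.sym (proj₁ (proj₂ lifted))) ld
    d′≋ = proj₂ (proj₂ lifted)

-- The field K(α): minimal polynomial and inverses

module RadicalExtension
  {ℓ : Level} (em : ExcludedMiddle ℓ) (R K L : CommutativeRing ℓ ℓ)
  (ι : CommutativeRing.Carrier R → CommutativeRing.Carrier K)
  (dedekind : IsDedekindWithQuotientField R K ι)
  (L-field : IsField L)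
  (κ : CommutativeRing.Carrier K → CommutativeRing.Carrier L) (κ-embedding : IsEmbedding K L κ)
  (n : ℕ) (a : CommutativeRing.Carrier R)
  (irreducible : Polynomial.Irreducible R (Polynomial.X^_-_ R n a))
  (α : CommutativeRing.Carrier L)
  (root : CommutativeRing._≈_ L (evalAt R L (κ ∘ ι) (Polynomial.X^_-_ R n a) α) (CommutativeRing.0# L))
  where
  open IsDedekindWithQuotientField dedekind
  open IsQuotientField isQuotientField
  open Dedekind em R K ι dedekind
  open MonicFactor em R K ι dedekind
  module R = CommutativeRing R
  module K = CommutativeRing K
  module L = CommutativeRing L
  module RP = PolynomialRing R
  module KP = PolynomialRing K
  module RPR = CommutativeRing RP.polyRing
  module KPR = CommutativeRing KP.polyRing
  module LS = IntegerSolver L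
  module RPS = IntegerSolver RP.polyRing

  open RawMagmaDefinitions (RawSemiring.*-rawMagma RP.polyRawSemiring) using (_,_) renaming (_∣_ to _∣ₚ_)

  φ : R.Carrier → L.Carrier
  φ = κ ∘ ι

  φ-embedding : IsEmbedding R L φ
  φ-embedding = Composition.isRingMonomorphism L.trans isEmbedding κ-embedding

  module κM = RingMorphisms.IsRingMonomorphism κ-embedding
  module φM = RingMorphisms.IsRingMonomorphism φ-embedding
  module ιM = RingMorphisms.IsRingMonomorphism isEmbedding
  module ER = Evaluation R L φ φM.isRingHomomorphism α
  module EK = Evaluation K L κ κM.isRingHomomorphism α
  open ER using () renaming (ev to evR) public
  open EK using () renaming (ev to evK) public
  open MapPolynomial R K ι ι-hom

  L-domain : IsDomain L
  L-domain = field⇒domain em L L-field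
  module LDom = Domain L L-domain

  f : RP.Poly
  f = RP.monic n (RP.const (R.- a))

  evK-map : ∀ p → evK (map ι p) L.≈ evR p
  evK-map p = L.reflexive (≡.cong (λ q → Polynomial.eval L q α) (≡.sym (map-∘ p)))

  fK : KP.Poly
  fK = KP.monic n (KP.const (ι (R.- a)))

  map-f : map ι f KP.≋ fK
  map-f = KPR.trans (map-+ (RP.X RP.^ n) (RP.const (R.- a)))
            (KPR.+-congʳ {KP.const (ι (R.- a))} (map-X^ n))

  fK-root : evK fK L.≈ L.0#
  fK-root = L.trans (EK.ev-cong fK (map ι f) (KPR.sym map-f)) (L.trans (evK-map f) root)

  -- For n = 0 the polynomial f would be the constant 1 - a, which is zero because it vanishes at α.
  -- But 0 = 0 · 0 is not irreducible, as 0 is no unit.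
  1≤n : 1 ≤ n
  1≤n = positive n irreducible root
    where
    positive : ∀ m → Polynomial.Irreducible R (Polynomial.X^_-_ R m a) →
               evR (RP.monic m (RP.const (R.- a))) L.≈ L.0# → 1 ≤ m
    positive zero irr ev≈0 = ⊥-elim (Sum.[ no-unit , no-unit ]′ (RP.Irreducible.split-∣1 irr {[]} {[]} (RP.≋⇒≈ zero-poly)))
      where
      c = R.1# R.+ R.- a
      c≈0 : c R.≈ R.0#
      c≈0 = φM.injective (L.trans (L.trans (L.sym (ER.ev-const c)) ev≈0) (L.sym φM.0#-homo))
      zero-poly : RP.monic 0 (RP.const (R.- a)) RP.≋ []
      zero-poly = RP.const-0 c≈0
      no-unit : ¬ ([] ∣ₚ RP.const R.1#)
      no-unit (u , eq) = IsDomain.0≉1 isDomain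
        (R.trans (R.sym (RP.≋⇒≈ (RPR.zeroʳ u) 0)) (eq 0))
    positive (ℕ.suc m) _ _ = s≤s z≤n

  -- The ideal for which `PrincipalModulo` speaks of K[x] itself.
  Zero : Pred K.Carrier ℓ
  Zero x = x K.≈ K.0#

  Zero-ideal : IsIdeal K Zero
  Zero-ideal = record
    { resp     = λ e x≈0 → K.trans (K.sym e) x≈0
    ; 0∈       = K.refl
    ; +-closed = λ e e′ → K.trans (K.+-cong e e′) (K.+-identityʳ _)
    ; *-closed = λ r e → K.trans (K.*-congˡ e) (K.zeroʳ r)
    }

  Zero-inverse : ∀ c → ¬ Zero c → ∃ λ c′ → ∃ λ x → Zero x ∧ c′ K.* c K.+ x K.≈ K.1#
  Zero-inverse c c≉0 = let (c′ , eq) = IsField.inverse isField c c≉0 in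
    c′ , K.0# , K.refl , K.trans (K.+-identityʳ _) (K.trans (K.*-comm c′ c) eq)

  module Z = CoefficientIdeal K Zero Zero-ideal

  Z⇒≋ : ∀ {p} → Z.Coeffs p → p KP.≋ []
  Z⇒≋ Zp = KP.≈⇒≋ (Z.coeff∈ Zp)

  module _ where
    private
      V : Pred KP.Poly ℓ
      V p = evK p L.≈ L.0#

      V-ideal : IsIdeal KP.polyRing V
      V-ideal = record
        { resp     = λ {p} {q} e Vp → L.trans (EK.ev-cong q p (KPR.sym e)) Vp
        ; 0∈       = L.refl
        ; +-closed = λ {p} {q} e e′ → L.trans (EK.ev-+ p q) (L.trans (L.+-cong e e′) (L.+-identityʳ _))
        ; *-closed = λ r {p} e → L.trans (EK.ev-* r p) (L.trans (L.*-congˡ e) (L.zeroʳ _))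
        }

      open PrincipalModulo K Zero Zero-ideal em Zero-inverse V V-ideal
        (λ p Zp → EK.ev-cong p [] (Z⇒≋ Zp))

      found = principal n (KP.const (ι (R.- a)) , 1≤n , fK-root)
      open Generator (proj₁ found)
      e = degree
      k = n ℕ.∸ e
      k+e : k ℕ.+ e ≡ n
      k+e = ℕ.m∸n+n≡m (proj₂ found)

      vanishing : ∀ r → length r ≤ e → evK r L.≈ L.0# → r KP.≋ []
      vanishing r l Vr = Z⇒≋ (lowest r l Vr)

      quotient : ∃ λ q → fK KP.≋ generator KP.*ₚ q
      quotient = let (q , r , Zr , eq) = divides fK fK-root in
        q , KPR.trans eq (KPR.trans (KPR.+-congˡ {generator KP.*ₚ q} (Z⇒≋ Zr)) (KPR.+-identityʳ _))

      monic-quotient : ∃ λ q′ → length q′ ≤ k ∧ proj₁ quotient KP.≋ KP.monic k q′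
      monic-quotient = KP.cofactor-monic e tail length≤ k (proj₁ quotient)
        (≡.subst (1 ≤_) (≡.sym k+e) 1≤n)
        (KPR.trans (KPR.*-comm (proj₁ quotient) generator) (KPR.trans (KPR.sym (proj₂ quotient))
          (KPR.reflexive (≡.cong (λ m → KP.monic m (KP.const (ι (R.- a)))) (≡.sym k+e)))))

      integral : ∃ λ d′ → length d′ ≤ e ∧ map ι d′ KP.≋ tail
      integral = let (q′ , lq , q≋) = monic-quotient in
        monic-factor e tail length≤ k q′ lq f
          (KPR.trans map-f (KPR.trans (proj₂ quotient) (KPR.*-congˡ {generator} q≋)))

      d = proj₁ integral
      ld = proj₁ (proj₂ integral)
      g = RP.monic e d

      map-g : map ι g KP.≋ generator
      map-g = KPR.trans (map-+ (RP.X RP.^ e) d) (KPR.+-cong (map-X^ e) (proj₂ (proj₂ integral)))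

      g-root : evR g L.≈ L.0#
      g-root = L.trans (L.sym (evK-map g)) (L.trans (EK.ev-cong (map ι g) generator map-g) V-monic)

      -- Since g is monic, the division takes place over R. The remainder has degree below e and
      -- vanishes at α, so it is zero by minimality of e.
      f-factors : ∃ λ q → f RP.≋ g RP.*ₚ q
      f-factors = q , RPR.trans f≋ (RPR.trans (RPR.+-congˡ {g RP.*ₚ q} r≋[]) (RPR.+-identityʳ _))
        where
        division = RP.divide-monic e d ld f
        q = proj₁ division
        r = proj₁ (proj₂ division)
        lr = proj₁ (proj₂ (proj₂ division))
        f≋ = proj₂ (proj₂ (proj₂ division))
        r-root : evR r L.≈ L.0#
        r-root = begin
          evR r                          ≈⟨ L.+-identityˡ _ ⟨
          L.0# L.+ evR r                 ≈⟨ L.+-congʳ (L.trans (L.*-congʳ g-root) (L.zeroˡ (evR q))) ⟨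
          evR g L.* evR q L.+ evR r      ≈⟨ L.+-congʳ (ER.ev-* g q) ⟨
          evR (g RP.*ₚ q) L.+ evR r      ≈⟨ ER.ev-+ (g RP.*ₚ q) r ⟨
          evR (g RP.*ₚ q RP.+ₚ r)        ≈⟨ ER.ev-cong f (g RP.*ₚ q RP.+ₚ r) f≋ ⟨
          evR f                          ≈⟨ root ⟩
          L.0#                           ∎
          where open SetoidReasoning L.setoid
        map-r≋[] : map ι r KP.≋ []
        map-r≋[] = vanishing (map ι r) (≡.subst (_≤ e) (≡.sym (length-map ι r)) lr) (L.trans (evK-map r) r-root)
        r≋[] : r RP.≋ []
        r≋[] = RP.≈⇒≋ λ i → ιM.injective (K.trans (K.sym (coeff-map r i))
                 (K.trans (KP.≋⇒≈ map-r≋[] i) (K.sym ιM.0#-homo)))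

      g∤1 : ¬ (g ∣ₚ RP.const R.1#)
      g∤1 (u , eq) = IsDomain.0≉1 L-domain (begin
        L.0#                  ≈⟨ L.trans (L.*-congˡ g-root) (L.zeroʳ (evR u)) ⟨
        evR u L.* evR g       ≈⟨ ER.ev-* u g ⟨
        evR (u RP.*ₚ g)       ≈⟨ ER.ev-cong (u RP.*ₚ g) (RP.const R.1#) (RP.≈⇒≋ eq) ⟩
        evR (RP.const R.1#)   ≈⟨ ER.ev-1 ⟩
        L.1#                  ∎)
        where open SetoidReasoning L.setoid

      q∣1⇒n≤e : proj₁ f-factors ∣ₚ RP.const R.1# → n ≤ e
      -- From u q = 1 follows u f = g. If e < n, a multiple of the monic f of such low degree forces
      -- u = 0.
      q∣1⇒n≤e (u , eq) = ℕ.≮⇒≥ λ e<n →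
        let (u′ , l , u≋) = RP.cofactor-length n (RP.const (R.- a)) 1≤n 0 u {g}
                              (ℕ.≤-trans (RP.length-monic d ld) e<n) uf≋g
        in zero-length u′ l u≋
        where
        q = proj₁ f-factors
        uf≋g : u RP.*ₚ f RP.≋ g
        uf≋g = RPR.trans (RPR.*-congˡ {u} (proj₂ f-factors)) (RPR.trans
          (RPS.solve 3 (λ u g q → u RPS.:* (g RPS.:* q) RPS.:= (u RPS.:* q) RPS.:* g) RPR.refl u g q)
          (RPR.trans (RPR.*-congʳ {g} {u RP.*ₚ q} {RP.const R.1#} (RP.≈⇒≋ eq)) (RPR.*-identityˡ g)))
        zero-length : ∀ u′ → length u′ ≤ 0 → ¬ u RP.≋ u′
        zero-length [] _ u≋ = IsDomain.0≉1 isDomain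
          (R.trans (R.sym (RP.≋⇒≈ (RPR.trans (RPR.*-congʳ {q} u≋) (RPR.zeroˡ q)) 0)) (eq 0))

      n≤e : n ≤ e
      n≤e = Sum.[ ⊥-elim ∘ g∤1 , q∣1⇒n≤e ]′
              (RP.Irreducible.split-∣1 irreducible (RP.≋⇒≈ (proj₂ f-factors)))

    -- The minimal polynomial g of α has degree n: it is a factor of f over R and not a unit,
    -- because it vanishes at α, so by irreducibility its cofactor is a unit.
    independent : ∀ r → length r ≤ n → evK r L.≈ L.0# → r KP.≋ []
    independent r l = vanishing r (ℕ.≤-trans l n≤e)

  -- The monic v of least degree with v(α) ∈ q(α) K[α] divides both q and f, hence is 1.
  invertible : ∀ q → ¬ evK q L.≈ L.0# → ∃ λ w → evK w L.* evK q L.≈ L.1#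
  invertible q q≉0 = go degree ≡.refl
    where
    V : Pred KP.Poly ℓ
    V v = ∃ λ u → evK v L.≈ evK u L.* evK q

    V-ideal : IsIdeal KP.polyRing V
    V-ideal = record
      { resp     = λ { {p} {p′} e (u , eq) → u , L.trans (EK.ev-cong p′ p (KPR.sym e)) eq }
      ; 0∈       = [] , L.sym (L.zeroˡ _)
      ; +-closed = λ { {p} {p′} (u , eq) (u′ , eq′) → u KP.+ₚ u′ ,
          L.trans (EK.ev-+ p p′) (L.trans (L.+-cong eq eq′)
            (L.trans (L.sym (L.distribʳ _ _ _)) (L.*-congʳ (L.sym (EK.ev-+ u u′))))) }
      ; *-closed = λ { r {p} (u , eq) → r KP.*ₚ u ,
          L.trans (EK.ev-* r p) (L.trans (L.*-congˡ eq)
            (L.trans (L.sym (L.*-assoc _ _ _)) (L.*-congʳ (L.sym (EK.ev-* r u))))) }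
      }

    open PrincipalModulo K Zero Zero-ideal em Zero-inverse V V-ideal
      (λ p Zp → [] , L.trans (EK.ev-cong p [] (Z⇒≋ Zp)) (L.sym (L.zeroˡ _)))
    found = principal n (KP.const (ι (R.- a)) , 1≤n , [] , L.trans fK-root (L.sym (L.zeroˡ _)))
    open Generator (proj₁ found)

    exact : ∀ p → V p → ∃ λ s → p KP.≋ generator KP.*ₚ s
    exact p Vp = let (s , r , Zr , eq) = divides p Vp in
      s , KPR.trans eq (KPR.trans (KPR.+-congˡ {generator KP.*ₚ s} (Z⇒≋ Zr)) (KPR.+-identityʳ _))

    q-multiple = exact q (KP.const K.1# , L.sym (L.trans (L.*-congʳ EK.ev-1) (L.*-identityˡ _)))
    f-multiple = exact fK ([] , L.trans fK-root (L.sym (L.zeroˡ _)))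
    s = proj₁ f-multiple

    generator≉0 : ¬ evK generator L.≈ L.0#
    generator≉0 e = q≉0 (L.trans (EK.ev-cong q _ (proj₂ q-multiple))
      (L.trans (EK.ev-* generator (proj₁ q-multiple)) (L.trans (L.*-congʳ e) (L.zeroˡ _))))

    s-root : evK s L.≈ L.0#
    s-root = LDom.*-≈0ʳ generator≉0 (L.trans (L.sym (EK.ev-* generator s))
      (L.trans (EK.ev-cong (generator KP.*ₚ s) fK (KPR.sym (proj₂ f-multiple))) fK-root))

    go : ∀ e → degree ≡ e → ∃ λ w → evK w L.* evK q L.≈ L.1#
    go zero deg≡0 =
      let (u , eq) = V-monic in u , L.trans (L.sym eq) (constant degree tail deg≡0 length≤)
      where
      constant : ∀ e d → e ≡ 0 → length d ≤ e → evK (KP.monic e d) L.≈ L.1#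
      constant zero [] _ _ = EK.ev-1
    -- The generator divides q, so it does not vanish at α and its cofactor s in f does. In positive
    -- degree s would have degree below n, whence s = 0 by `independent`, and f = 0.
    go (ℕ.suc e) deg≡ =
      let (s′ , l , s≋) = KP.cofactor-length degree tail length≤ n s {fK}
            (ℕ.≤-trans (KP.length-monic (KP.const (ι (R.- a))) 1≤n)
              (≡.subst (λ m → ℕ.suc n ≤ n ℕ.+ m) (≡.sym deg≡)
                (≡.subst (ℕ.suc n ≤_) (≡.sym (ℕ.+-suc n e)) (s≤s (ℕ.m≤m+n n e)))))
            (KPR.trans (KPR.*-comm s generator) (KPR.sym (proj₂ f-multiple)))
          s≋[] = KPR.trans s≋ (independent s′ l (L.trans (EK.ev-cong s′ s (KPR.sym s≋)) s-root))
          fK≋[] = KPR.trans (proj₂ f-multiple) (KPR.trans (KPR.*-congˡ {generator} s≋[]) (KPR.zeroʳ generator))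
      in ⊥-elim (IsDomain.0≉1 K-domain (K.trans (K.sym (KP.≋⇒≈ fK≋[] n))
           (KP.coeff-monic n (KP.const (ι (R.- a))) 1≤n)))

-- Square-free elements and uniformizers

module SquareFreeElement {ℓ : Level} (em : ExcludedMiddle ℓ) (R K : CommutativeRing ℓ ℓ)
                         (ι : CommutativeRing.Carrier R → CommutativeRing.Carrier K)
                         (dedekind : IsDedekindWithQuotientField R K ι) where
  open Dedekind em R K ι dedekind
  open CommutativeRing R
  private module S = IntegerSolver R

  module _ {P : Pred Carrier ℓ} (P-prime : IsPrimeIdeal R P) (P≉0 : NonZeroIdeal P)
           (U : Uniformizer P-prime P≉0) where
    open IsPrimeIdeal P-prime using (isIdeal)
    open Uniformizer U

    P² : Pred Carrier ℓ
    P² = IdealProduct R P P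

    -- If also a′ ∈ P, then aR = P² C for C = (aR : P²).
    square-free⇒cofactor∉P : ∀ {a a′} → SquareFree R a → P a → c * a ≈ π * a′ → ¬ P a′
    square-free⇒cofactor∉P {a} {a′} square-free Pa ca≈ Pa′ =
      square-free P P-prime (C , C-ideal , a⊆ , ⊆a)
      where
      C : Pred Carrier ℓ
      C x = ∀ p q → P p → P q → ∃ λ y → x * (p * q) ≈ a * y

      C-ideal : IsIdeal R C
      C-ideal = record
        { resp     = λ e Cx p q Pp Pq → let (y , eq) = Cx p q Pp Pq in y , trans (*-congʳ (sym e)) eq
        ; 0∈       = λ p q _ _ → 0# , trans (zeroˡ _) (sym (zeroʳ a))
        ; +-closed = λ Cx Cy p q Pp Pq →
            let (y , eq) = Cx p q Pp Pq
                (z , eq′) = Cy p q Pp Pq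
            in y + z , trans (distribʳ _ _ _) (trans (+-cong eq eq′) (sym (distribˡ _ _ _)))
        ; *-closed = λ r {x} Cx p q Pp Pq → let (y , eq) = Cx p q Pp Pq in
            r * y , trans (*-assoc r x _) (trans (*-congˡ eq)
              (S.solve 3 (λ r a y → r S.:* (a S.:* y) S.:= a S.:* (r S.:* y)) refl r a y))
        }

      P²C : Pred Carrier ℓ
      P²C = IdealProduct R P² C

      product∈ : ∀ p q x → P p → P q → C x → P²C (p * q * x)
      product∈ p q x Pp Pq Cx = gen (p * q , x , gen (p , q , Pp , Pq , refl) , Cx , refl)

      a″ = proj₁ (divides Pa′)
      ca′≈ : c * a′ ≈ π * a″
      ca′≈ = proj₂ (divides Pa′)

      cca≈ : c * (c * a) ≈ π * (π * a″)
      cca≈ = trans (*-congˡ ca≈) (trans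
        (S.solve 3 (λ c p x → c S.:* (p S.:* x) S.:= p S.:* (c S.:* x)) refl c π a′) (*-congˡ ca′≈))

      Ca″ : C a″
      -- With c p = π p′ and c q = π q′, the equation c² a = π² a″ becomes π² a″ p q = π² a p′ q′.
      Ca″ p q Pp Pq = p′ * q′ , RDom.*-cancel (RDom.*-≉0 π≉0 π≉0) (begin
        π * π * (a″ * (p * q))
          ≈⟨ S.solve 3 (λ u x y → u S.:* u S.:* (x S.:* y) S.:= u S.:* (u S.:* x) S.:* y) refl π a″ (p * q) ⟩
        π * (π * a″) * (p * q)     ≈⟨ *-congʳ cca≈ ⟨
        c * (c * a) * (p * q)
          ≈⟨ S.solve 4 (λ c a p q → c S.:* (c S.:* a) S.:* (p S.:* q) S.:= a S.:* ((c S.:* p) S.:* (c S.:* q)))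
               refl c a p q ⟩
        a * ((c * p) * (c * q))    ≈⟨ *-congˡ (*-cong p≈ q≈) ⟩
        a * ((π * p′) * (π * q′))
          ≈⟨ S.solve 4 (λ u a p q → a S.:* ((u S.:* p) S.:* (u S.:* q)) S.:= u S.:* u S.:* (a S.:* (p S.:* q)))
               refl π a p′ q′ ⟩
        π * π * (a * (p′ * q′))    ∎)
        where
        open SetoidReasoning setoid
        p′ = proj₁ (divides Pp)
        p≈ = proj₂ (divides Pp)
        q′ = proj₁ (divides Pq)
        q≈ = proj₂ (divides Pq)

      Ca : C a
      Ca p q _ _ = p * q , refl

      cca∈ : P²C (c * (c * a))
      cca∈ = Generated.resp
        (trans (*-assoc π π a″) (sym cca≈)) (product∈ π π a″ π∈P π∈P Ca″)

      -- 1 = (c′ c + x)³ ∈ c² R + x² R.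
      a∈ : P²C a
      a∈ =
        let (c′ , x , Px , 1≈) = inverse-mod P-prime P≉0 c c∉P
            u = c′ * c
        in Generated.resp (begin
          (c′ * c′ * (u + x + x + x)) * (c * (c * a)) + (u + u + u + x) * (x * x * a)
            ≈⟨ S.solve 4 (λ d c x a →
                 (d S.:* d S.:* (d S.:* c S.:+ x S.:+ x S.:+ x)) S.:* (c S.:* (c S.:* a))
                   S.:+ (d S.:* c S.:+ d S.:* c S.:+ d S.:* c S.:+ x) S.:* (x S.:* x S.:* a)
                 S.:= (d S.:* c S.:+ x) S.:* ((d S.:* c S.:+ x) S.:* ((d S.:* c S.:+ x) S.:* a)))
               refl c′ c x a ⟩
          (u + x) * ((u + x) * ((u + x) * a))   ≈⟨ *-cong 1≈ (*-cong 1≈ (*-congʳ 1≈)) ⟩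
          1# * (1# * (1# * a))                  ≈⟨ trans (*-identityˡ _) (trans (*-identityˡ _) (*-identityˡ a)) ⟩
          a                                     ∎)
          (Generated.+-closed (Generated.*-closed _ cca∈)
                              (Generated.*-closed _ (product∈ x x a Px Px Ca)))
        where open SetoidReasoning setoid

      a⊆ : ∀ {x} → PrincipalIdeal R a x → P²C x
      a⊆ (gen a≈x)                = Generated.resp a≈x a∈
      a⊆ (Generated.resp e x)     = Generated.resp e (a⊆ x)
      a⊆ Generated.0∈             = Generated.0∈
      a⊆ (Generated.+-closed x y) = Generated.+-closed (a⊆ x) (a⊆ y)
      a⊆ (Generated.*-closed r x) = Generated.*-closed r (a⊆ x)

      P²*C : ∀ {x y} → P² x → C y → PrincipalIdeal R a (x * y)
      P²*C {y = y} (gen (p , q , Pp , Pq , x≈)) Cy =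
        let (w , eq) = Cy p q Pp Pq in
        Generated.resp (trans (*-comm w a) (trans (sym eq) (trans (*-comm _ _) (*-congʳ (sym x≈)))))
          (Generated.*-closed w (gen refl))
      P²*C (Generated.resp e x)     Cy = Generated.resp (*-congʳ e) (P²*C x Cy)
      P²*C Generated.0∈             Cy = Generated.resp (sym (zeroˡ _)) Generated.0∈
      P²*C (Generated.+-closed x y) Cy = Generated.resp (sym (distribʳ _ _ _)) (Generated.+-closed (P²*C x Cy) (P²*C y Cy))
      P²*C (Generated.*-closed r x) Cy = Generated.resp (sym (*-assoc r _ _)) (Generated.*-closed r (P²*C x Cy))

      ⊆a : ∀ {x} → P²C x → PrincipalIdeal R a x
      ⊆a (gen (x , y , P²x , Cy , z≈)) = Generated.resp (sym z≈) (P²*C P²x Cy)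
      ⊆a (Generated.resp e x)     = Generated.resp e (⊆a x)
      ⊆a Generated.0∈             = Generated.0∈
      ⊆a (Generated.+-closed x y) = Generated.+-closed (⊆a x) (⊆a y)
      ⊆a (Generated.*-closed r x) = Generated.*-closed r (⊆a x)

-- The ring A = R[α] and almost integral elements

module IntegralElements
  {ℓ : Level} (em : ExcludedMiddle ℓ) (R K L : CommutativeRing ℓ ℓ)
  (ι : CommutativeRing.Carrier R → CommutativeRing.Carrier K)
  (dedekind : IsDedekindWithQuotientField R K ι)
  (L-field : IsField L)
  (κ : CommutativeRing.Carrier K → CommutativeRing.Carrier L) (κ-embedding : IsEmbedding K L κ)
  (n : ℕ) (a : CommutativeRing.Carrier R)
  (irreducible : Polynomial.Irreducible R (Polynomial.X^_-_ R n a))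
  (α : CommutativeRing.Carrier L)
  (root : CommutativeRing._≈_ L (evalAt R L (κ ∘ ι) (Polynomial.X^_-_ R n a) α) (CommutativeRing.0# L))
  where
  open IsDedekindWithQuotientField dedekind
  open Dedekind em R K ι dedekind
  open MonicFactor em R K ι dedekind
  open RadicalExtension em R K L ι dedekind L-field κ κ-embedding n a irreducible α root public
  open MapPolynomial R K ι ι-hom
  open CommutativeRing L
  open RingProperties ring
  open LS using (solve; _:=_; _:+_; _:*_; _:-_; :-_)
  open Exp semiring
  open CommutativeExp commutativeSemiring using (^-distrib-*)

  A : Pred Carrier ℓ
  A = Adjoin R L φ α

  A-resp : ∀ {x y} → x ≈ y → A x → A y
  A-resp e (p , eq) = p , trans (sym e) eq

  A-+ : ∀ {x y} → A x → A y → A (x + y)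
  A-+ (p , eq) (q , eq′) = p RP.+ₚ q , trans (+-cong eq eq′) (sym (ER.ev-+ p q))

  A-* : ∀ {x y} → A x → A y → A (x * y)
  A-* (p , eq) (q , eq′) = p RP.*ₚ q , trans (*-cong eq eq′) (sym (ER.ev-* p q))

  A-neg : ∀ {x} → A x → A (- x)
  A-neg (p , eq) = RP.-ₚ p , trans (-‿cong eq) (sym (ER.ev-neg p))

  A-φ : ∀ r → A (φ r)
  A-φ r = RP.const r , sym (ER.ev-const r)

  A-ev : ∀ p → A (evR p)
  A-ev p = p , refl

  A-α : A α
  A-α = RP.X , sym ER.ev-X

  A-0 : A 0#
  A-0 = [] , refl

  A-1 : A 1#
  A-1 = A-resp φM.1#-homo (A-φ R.1#)

  A-^ : ∀ {x} k → A x → A (x ^ k)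
  A-^ zero      Ax = A-1
  A-^ (ℕ.suc k) Ax = A-* Ax (A-^ k Ax)

  -- Reduced modulo f, the polynomial representing κ x has degree below n. By `independent` it
  -- equals the constant x over K, so x is its constant coefficient.
  A∩K : ∀ x → A (κ x) → ∃ λ r → x K.≈ ι r
  A∩K x (p , eq) = RP.coeff r 0 , K.sym (K.trans (K.sym (coeff-map r 0)) (begin
      KP.coeff (map ι r) 0                       ≈⟨ K.+-identityʳ _ ⟨
      KP.coeff (map ι r) 0 K.+ K.0#              ≈⟨ K.+-congˡ (K.-‿inverseˡ x) ⟨
      KP.coeff (map ι r) 0 K.+ (K.- x K.+ x)     ≈⟨ K.+-assoc _ _ _ ⟨
      KP.coeff (map ι r) 0 K.+ K.- x K.+ x       ≈⟨ K.+-congʳ (KP.coeff-+ (map ι r) (KP.const (K.- x)) 0) ⟨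
      KP.coeff (map ι r KP.+ₚ KP.const (K.- x)) 0 K.+ x
        ≈⟨ K.+-congʳ (KP.≋⇒≈ difference≋[] 0) ⟩
      K.0# K.+ x                                 ≈⟨ K.+-identityˡ x ⟩
      x                                          ∎))
    where
    division = RP.divide-monic n (RP.const (R.- a)) 1≤n p
    q = proj₁ division
    r = proj₁ (proj₂ division)
    evR-r : evR r ≈ κ x
    evR-r = begin
      evR r                          ≈⟨ +-identityˡ _ ⟨
      0# + evR r                     ≈⟨ +-congʳ (trans (*-congʳ root) (zeroˡ (evR q))) ⟨
      evR f * evR q + evR r          ≈⟨ +-congʳ (ER.ev-* f q) ⟨
      evR (f RP.*ₚ q) + evR r        ≈⟨ ER.ev-+ (f RP.*ₚ q) r ⟨
      evR (f RP.*ₚ q RP.+ₚ r)        ≈⟨ ER.ev-cong p (f RP.*ₚ q RP.+ₚ r) (proj₂ (proj₂ (proj₂ division))) ⟨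
      evR p                          ≈⟨ eq ⟨
      κ x                            ∎
      where open SetoidReasoning setoid
    difference≋[] : map ι r KP.+ₚ KP.const (K.- x) KP.≋ []
    difference≋[] = independent _
      (KP.length-+ₚ (map ι r) (KP.const (K.- x))
        (≡.subst (_≤ n) (≡.sym (length-map ι r)) (proj₁ (proj₂ (proj₂ division)))) 1≤n)
      (trans (EK.ev-+ (map ι r) (KP.const (K.- x)))
        (trans (+-cong (trans (evK-map r) evR-r) (trans (EK.ev-const (K.- x)) (κM.-‿homo x)))
          (-‿inverseʳ (κ x))))
    open SetoidReasoning K.setoid

  -- By `invertible`, y is a polynomial in α over K, and a common denominator of its coefficients
  -- serves.
  denominator : ∀ {y} → AdjoinField K L κ α y → ∃ λ d → ¬ d R.≈ R.0# ∧ A (φ d * y)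
  denominator {y} (p , q , q≉0 , eq) =
    let (w , wq≈1) = invertible q q≉0
        (d , d≉0 , p′ , multiple) = clear-denominators (p KP.*ₚ w)
    in d , d≉0 , p′ , (begin
      φ d * y                      ≈⟨ *-congˡ (*-identityʳ y) ⟨
      φ d * (y * 1#)               ≈⟨ *-congˡ (*-congˡ wq≈1) ⟨
      φ d * (y * (evK w * evK q))
        ≈⟨ *-congˡ (solve 3 (λ y w q → y :* (w :* q) := y :* q :* w) refl y (evK w) (evK q)) ⟩
      φ d * (y * evK q * evK w)    ≈⟨ *-congˡ (*-congʳ eq) ⟩
      φ d * (evK p * evK w)        ≈⟨ *-cong (EK.ev-const (ι d)) (EK.ev-* p w) ⟨
      evK (KP.const (ι d)) * evK (p KP.*ₚ w)   ≈⟨ EK.ev-* (KP.const (ι d)) (p KP.*ₚ w) ⟨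
      evK (KP.const (ι d) KP.*ₚ (p KP.*ₚ w))
        ≈⟨ EK.ev-cong (map ι p′) (KP.const (ι d) KP.*ₚ (p KP.*ₚ w)) (IsMultiple⇒≋ multiple) ⟨
      evK (map ι p′)               ≈⟨ evK-map p′ ⟩
      evR p′                       ∎)
    where open SetoidReasoning setoid

  AlmostIntegral : Pred Carrier ℓ
  AlmostIntegral y = ∃ λ d → ¬ d R.≈ R.0# ∧ (∀ k → A (φ d * y ^ k))

  almost-integral-* : ∀ {s y} → A s → AlmostIntegral y → AlmostIntegral (s * y)
  almost-integral-* {s} {y} As (d , d≉0 , powers) = d , d≉0 , λ k → A-resp
    (trans (solve 3 (λ s d y → s :* (d :* y) := d :* (s :* y)) refl (s ^ k) (φ d) (y ^ k))
      (*-congˡ (sym (^-distrib-* s y k))))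
    (A-* (A-^ k As) (powers k))

  -- Induction on k over the mixed products d yʲ (y - s)ᵏ, with j free, takes the place of the
  -- binomial expansion.
  almost-integral-- : ∀ {s y} → A s → AlmostIntegral y → AlmostIntegral (y - s)
  almost-integral-- {s} {y} As (d , d≉0 , powers) = d , d≉0 , λ k →
    A-resp (*-congʳ (*-identityʳ (φ d))) (mixed k 0)
    where
    mixed : ∀ k j → A (φ d * y ^ j * (y - s) ^ k)
    mixed zero      j = A-resp (sym (*-identityʳ _)) (powers j)
    mixed (ℕ.suc k) j = A-resp
      (solve 5 (λ d y z s w → d :* (y :* z) :* w :+ :- (s :* (d :* z :* w)) := d :* z :* ((y :- s) :* w)) refl
         (φ d) y (y ^ j) s ((y - s) ^ k))
      (A-+ (mixed k (ℕ.suc j)) (A-neg (A-* As (mixed k j))))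

  -- If y satisfies a monic equation of degree m, then dᵐ is a suitable denominator: it clears yⁱ
  -- for i ≤ m, and the equation moves the window of exponents k, ..., k + m upwards.
  integral⇒almost-integral : ∀ {y} → (∃ λ d → ¬ d R.≈ R.0# ∧ A (φ d * y)) → IsIntegralOver L A y → AlmostIntegral y
  integral⇒almost-integral {y} (d , d≉0 , Ady) (p , Ap , p≈0) =
    d^ m , d^≉0 m , λ k → A-resp (*-congˡ (^-congʳ y (ℕ.+-identityʳ k))) (window k 0 z≤n)
    where
    m = length p

    d^ : ℕ → R.Carrier
    d^ zero      = R.1#
    d^ (ℕ.suc m) = d R.* d^ m

    d^≉0 : ∀ m → ¬ d^ m R.≈ R.0#
    d^≉0 zero      e = IsDomain.0≉1 isDomain (R.sym e)
    d^≉0 (ℕ.suc m) = RDom.*-≉0 d≉0 (d^≉0 m)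

    W : ℕ → Set ℓ
    W k = A (φ (d^ m) * y ^ k)

    initial : ∀ m i → i ≤ m → A (φ (d^ m) * y ^ i)
    initial m zero _ = A-resp (sym (*-identityʳ _)) (A-φ (d^ m))
    initial (ℕ.suc m) (ℕ.suc i) (s≤s i≤m) = A-resp
      (trans (solve 4 (λ d y e z → (d :* y) :* (e :* z) := d :* e :* (y :* z)) refl (φ d) y (φ (d^ m)) (y ^ i))
        (*-congʳ (sym (φM.*-homo d (d^ m)))))
      (A-* Ady (initial m i i≤m))

    combination : ∀ q → All A q → ∀ k → (∀ i → i < length q → W (k ℕ.+ i)) →
                  A (φ (d^ m) * y ^ k * Polynomial.eval L q y)
    combination [] _ k _ = A-resp (sym (zeroʳ _)) A-0
    combination (c ∷ q) (Ac ∷ Aq) k Wk = A-resp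
      (solve 5 (λ d z c y e → c :* (d :* z) :+ d :* (y :* z) :* e := d :* z :* (c :+ y :* e)) refl
        (φ (d^ m)) (y ^ k) c y (Polynomial.eval L q y))
      (A-+ (A-* Ac (≡.subst W (ℕ.+-identityʳ k) (Wk 0 (s≤s z≤n))))
           (combination q Aq (ℕ.suc k) λ i i< → ≡.subst W (ℕ.+-suc k i) (Wk (ℕ.suc i) (s≤s i<))))

    window : ∀ k i → i ≤ m → W (k ℕ.+ i)
    window zero      i i≤m = initial m i i≤m
    window (ℕ.suc k) i i≤m = Sum.[ shift , (λ { ≡.refl → top }) ]′ (ℕ.m≤n⇒m<n∨m≡n i≤m)
      where
      shift : ∀ {i} → i < m → W (ℕ.suc k ℕ.+ i)
      shift {i} i<m = ≡.subst W (ℕ.+-suc k i) (window k (ℕ.suc i) i<m)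

      top : W (ℕ.suc k ℕ.+ m)
      -- The equation times dᵐ y^(k + 1) expresses the new top exponent by the m exponents before
      -- it.
      top = A-resp (begin
        - (φ (d^ m) * y ^ ℕ.suc k * e)
          ≈⟨ solve 4 (λ d z e t → :- (d :* z :* e) := d :* (z :* t) :- d :* z :* (t :+ e)) refl
               (φ (d^ m)) (y ^ ℕ.suc k) e (y ^ m) ⟩
        φ (d^ m) * (y ^ ℕ.suc k * y ^ m) - φ (d^ m) * y ^ ℕ.suc k * (y ^ m + e)
          ≈⟨ +-congˡ (trans (-‿cong (trans (*-congˡ p≈0) (zeroʳ _))) -0#≈0#) ⟩
        φ (d^ m) * (y ^ ℕ.suc k * y ^ m) + 0#
          ≈⟨ trans (+-identityʳ _) (*-congˡ (sym (^-homo-* y (ℕ.suc k) m))) ⟩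
        φ (d^ m) * y ^ (ℕ.suc k ℕ.+ m) ∎)
        (A-neg (combination p Ap (ℕ.suc k) λ i → shift))
        where
        open SetoidReasoning setoid
        e = Polynomial.eval L p y

-- Reduction modulo P: the powers of α and separability

module IntegralClosure
  {ℓ : Level} (em : ExcludedMiddle ℓ) (R K L : CommutativeRing ℓ ℓ)
  (ι : CommutativeRing.Carrier R → CommutativeRing.Carrier K)
  (dedekind : IsDedekindWithQuotientField R K ι)
  (L-field : IsField L)
  (κ : CommutativeRing.Carrier K → CommutativeRing.Carrier L) (κ-embedding : IsEmbedding K L κ)
  (n : ℕ) (a : CommutativeRing.Carrier R) (square-free : SquareFree R a)
  (irreducible : Polynomial.Irreducible R (Polynomial.X^_-_ R n a))
  (α : CommutativeRing.Carrier L)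
  (root : CommutativeRing._≈_ L (evalAt R L (κ ∘ ι) (Polynomial.X^_-_ R n a) α) (CommutativeRing.0# L))
  (n∈P⇒a∈P : ∀ P → IsPrimeIdeal R P →
             P (_×_ (CommutativeRing.+-rawMonoid R) n (CommutativeRing.1# R)) → P a)
  where
  open IsDedekindWithQuotientField dedekind
  open IsQuotientField isQuotientField
  open Dedekind em R K ι dedekind
  open MonicFactor em R K ι dedekind
  open SquareFreeElement em R K ι dedekind
  open IntegralElements em R K L ι dedekind L-field κ κ-embedding n a irreducible α root
  open CommutativeRing L
  open RingProperties ring
  open LS using (solve; _:=_; _:+_; _:*_; _:-_; :-_)
  open Exp semiring
  open CommutativeExp commutativeSemiring using (^-distrib-*)
  private module RE = Exp R.semiring

  α^n≈φa : α ^ n ≈ φ a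
  α^n≈φa = x∙y⁻¹≈ε⇒x≈y (α ^ n) (φ a) (begin
    α ^ n - φ a                                      ≈⟨ +-cong (ER.ev-X^ n) (trans (ER.ev-const (R.- a)) (φM.-‿homo a)) ⟨
    evR (RP.X RP.^ n) + evR (RP.const (R.- a))       ≈⟨ ER.ev-+ (RP.X RP.^ n) (RP.const (R.- a)) ⟨
    evR f                                            ≈⟨ root ⟩
    0#                                               ∎)
    where open SetoidReasoning setoid

  -- A stand-in for a/α: the witness b is αⁿ⁻¹, available because 1 ≤ n.
  α-cofactor : ∃ λ b → A b ∧ α * b ≈ φ a
  α-cofactor = go n 1≤n α^n≈φa
    where
    go : ∀ m → 1 ≤ m → α ^ m ≈ φ a → ∃ λ b → A b ∧ α * b ≈ φ a
    go (ℕ.suc m) _ eq = α ^ m , A-^ m A-α , eq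

  -- The factor α turns m αᵐ⁻¹ into m αᵐ, so that m has no predecessor to be formed.
  α*D[X^] : ∀ m → α * evR (RP.D (RP.X RP.^ m)) ≈ φ (_×_ R.+-rawMonoid m R.1#) * α ^ m
  α*D[X^] zero = begin
    α * (φ R.0# + α * 0#)   ≈⟨ *-congˡ (trans (+-cong φM.0#-homo (zeroʳ α)) (+-identityʳ 0#)) ⟩
    α * 0#                  ≈⟨ zeroʳ α ⟩
    0#                      ≈⟨ trans (*-congʳ φM.0#-homo) (zeroˡ 1#) ⟨
    φ R.0# * 1#             ∎
    where open SetoidReasoning setoid
  α*D[X^] (ℕ.suc m) = begin
    α * evR (RP.D (RP.X RP.*ₚ Xᵐ))
      ≈⟨ *-congˡ (ER.ev-cong _ (Xᵐ RP.+ₚ RP.X RP.*ₚ RP.D Xᵐ) D-X*) ⟩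
    α * evR (Xᵐ RP.+ₚ RP.X RP.*ₚ RP.D Xᵐ)
      ≈⟨ *-congˡ (trans (ER.ev-+ Xᵐ (RP.X RP.*ₚ RP.D Xᵐ))
           (+-cong (ER.ev-X^ m) (trans (ER.ev-* RP.X (RP.D Xᵐ)) (*-congʳ ER.ev-X)))) ⟩
    α * (α ^ m + α * evR (RP.D Xᵐ))                  ≈⟨ *-congˡ (+-congˡ (α*D[X^] m)) ⟩
    α * (α ^ m + φ m1 * α ^ m)
      ≈⟨ solve 3 (λ a z r → a :* (z :+ r :* z) := (LS.:1 :+ r) :* (a :* z)) refl α (α ^ m) (φ m1) ⟩
    (1# + φ m1) * (α * α ^ m)
      ≈⟨ *-congʳ (trans (φM.+-homo R.1# m1) (+-congʳ φM.1#-homo)) ⟨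
    φ (R.1# R.+ m1) * α ^ ℕ.suc m                    ∎
    where
    open SetoidReasoning setoid
    Xᵐ = RP.X RP.^ m
    m1 = _×_ R.+-rawMonoid m R.1#
    DX : RP.D RP.X RP.≋ RP.const R.1#
    DX = RPR.trans (RPR.+-congˡ {RP.const R.1#} (RPR.trans (R.refl RP.∷-cong RP.0∷-[]) RP.0∷-[])) (RPR.+-identityʳ _)
    D-X* : RP.D (RP.X RP.*ₚ Xᵐ) RP.≋ Xᵐ RP.+ₚ RP.X RP.*ₚ RP.D Xᵐ
    D-X* = RPR.trans (RP.D-* RP.X Xᵐ) (RPR.+-congʳ {RP.X RP.*ₚ RP.D Xᵐ}
             (RPR.trans (RPR.*-congʳ {Xᵐ} DX) (RPR.*-identityˡ Xᵐ)))

  -- This expresses separability: α f′(α) is the element n a of R, and it is outside a prime P as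
  -- soon as n and a are.
  α*Df : α * evR (RP.D f) ≈ φ (_×_ R.+-rawMonoid n R.1# R.* a)
  α*Df = begin
    α * evR (RP.D f)                        ≈⟨ *-congˡ (ER.ev-cong (RP.D f) (RP.D (RP.X RP.^ n)) Df) ⟩
    α * evR (RP.D (RP.X RP.^ n))            ≈⟨ α*D[X^] n ⟩
    φ n1 * α ^ n                            ≈⟨ *-congˡ α^n≈φa ⟩
    φ n1 * φ a                              ≈⟨ φM.*-homo n1 a ⟨
    φ (n1 R.* a)                            ∎
    where
    open SetoidReasoning setoid
    n1 = _×_ R.+-rawMonoid n R.1#
    Df : RP.D f RP.≋ RP.D (RP.X RP.^ n)
    Df = RPR.trans (RP.D-+ (RP.X RP.^ n) (RP.const (R.- a)))
           (RPR.trans (RPR.+-congˡ {RP.D (RP.X RP.^ n)} RP.0∷-[]) (RPR.+-identityʳ _))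

  module _ {P : Pred R.Carrier ℓ} (P-prime : IsPrimeIdeal R P) (P≉0 : NonZeroIdeal P) where
    open IsPrimeIdeal P-prime using (isIdeal; 1∉; prime)
    open CoefficientIdeal R P isIdeal

    PA : Pred Carrier ℓ
    PA y = ∃ λ p → Coeffs p ∧ y ≈ evR p

    PA-resp : ∀ {x y} → x ≈ y → PA x → PA y
    PA-resp e (p , Pp , eq) = p , Pp , trans (sym e) eq

    PA-0 : PA 0#
    PA-0 = [] , Coeffs-[] , refl

    PA-+ : ∀ {x y} → PA x → PA y → PA (x + y)
    PA-+ (p , Pp , eq) (q , Pq , eq′) =
      p RP.+ₚ q , Coeffsᴵ.+-closed Pp Pq , trans (+-cong eq eq′) (sym (ER.ev-+ p q))

    PA-* : ∀ {x y} → A x → PA y → PA (x * y)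
    PA-* (p , eq) (q , Pq , eq′) =
      p RP.*ₚ q , Coeffsᴵ.*-closed p Pq , trans (*-cong eq eq′) (sym (ER.ev-* p q))

    PA-φ : ∀ {r y} → P r → A y → PA (φ r * y)
    PA-φ {r} Pr Ay = PA-resp (*-comm _ _) (PA-* Ay (RP.const r , Coeffs-const Pr , sym (ER.ev-const r)))

    -- r is invertible modulo P, so it acts injectively on A/PA.
    PA-cancel : ∀ {r y} → ¬ P r → A y → PA (φ r * y) → PA y
    PA-cancel {r} {y} ¬Pr Ay PAry =
      let (r′ , x , Px , 1≈) = inverse-mod P-prime P≉0 r ¬Pr in
      PA-resp (begin
        φ r′ * (φ r * y) + φ x * y  ≈⟨ solve 4 (λ r s x y → r :* (s :* y) :+ x :* y := (r :* s :+ x) :* y) refl (φ r′) (φ r) (φ x) y ⟩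
        (φ r′ * φ r + φ x) * y      ≈⟨ *-congʳ (+-congʳ (φM.*-homo r′ r)) ⟨
        (φ (r′ R.* r) + φ x) * y    ≈⟨ *-congʳ (φM.+-homo _ x) ⟨
        φ (r′ R.* r R.+ x) * y      ≈⟨ *-congʳ (trans (φM.⟦⟧-cong 1≈) φM.1#-homo) ⟩
        1# * y                      ≈⟨ *-identityˡ y ⟩
        y                           ∎)
        (PA-+ (PA-* (A-φ r′) PAry) (PA-φ Px Ay))
      where open SetoidReasoning setoid

    -- Let d generate the annihilator of z modulo P and f = d s.  As z is itself in the
    -- annihilator, so is s; hence d² divides f and f′(α) kills z modulo P.
    square-root : ¬ P a → ∀ {z} → A z → PA (z * z) → PA z
    -- f′(α) z ∈ PA, multiplied by α, becomes n a z ∈ PA, and n a ∉ P can be cancelled.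
    square-root ¬Pa {z} Az@(g , z≈g) PAzz = PA-cancel ¬Pna Az (PA-resp
      (trans (sym (*-assoc _ _ _)) (*-congʳ α*Df)) (PA-* A-α (V-Df (proj₁ (principal n (RP.const (R.- a) , 1≤n , Vf))))))
      where
      ¬Pna : ¬ P (_×_ R.+-rawMonoid n R.1# R.* a)
      -- n ∈ P would put a into P by the hypothesis on prime ideals.
      ¬Pna Pna = ¬Pa (Sum.[ n∈P⇒a∈P P P-prime , (λ Pa → Pa) ]′ (prime _ _ Pna))

      V : Pred RP.Poly ℓ
      V u = PA (evR u * z)

      V-ideal : IsIdeal RP.polyRing V
      V-ideal = record
        { resp     = λ {p} {q} e → PA-resp (*-congʳ (ER.ev-cong p q e))
        ; 0∈       = PA-resp (sym (zeroˡ z)) PA-0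
        ; +-closed = λ {p} {q} Vp Vq → PA-resp
            (trans (sym (distribʳ z _ _)) (*-congʳ (sym (ER.ev-+ p q)))) (PA-+ Vp Vq)
        ; *-closed = λ r {p} Vp → PA-resp
            (trans (sym (*-assoc _ _ _)) (*-congʳ (sym (ER.ev-* r p)))) (PA-* (A-ev r) Vp)
        }
      module Vᴵ = IdealProperties RP.polyRing V V-ideal

      P⊆V : ∀ p → Coeffs p → V p
      P⊆V p Pp = PA-resp (*-comm _ _) (PA-* Az (p , Pp , refl))

      open PrincipalModulo R P isIdeal em (inverse-mod P-prime P≉0) V V-ideal P⊆V

      Vf : V f
      Vf = PA-resp (sym (trans (*-congʳ root) (zeroˡ z))) PA-0

      module _ (G : Generator) where
        open Generator G renaming (generator to d)

        V-s : ∀ s r → Coeffs r → f RP.≋ d RP.*ₚ s RP.+ₚ r → V s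
        -- Here z = g(α), and z² ∈ PA puts g into V, so g ≡ d w modulo P[x]. Then s g ≡ d s w ≡ f w,
        -- that is s g = f w + t with t ∈ P[x], and f(α) = 0.
        V-s s r Pr f≋ =
          let (w , r′ , Pr′ , g≋) = divides g (PA-resp (*-congʳ z≈g) PAzz)
              t = s RP.*ₚ r′ RP.+ₚ RP.-ₚ (w RP.*ₚ r)
          in t , Coeffsᴵ.+-closed (Coeffsᴵ.*-closed s Pr′) (Coeffsᴵ.neg-closed (Coeffsᴵ.*-closed w Pr)) ,
             (begin
               evR s * z                        ≈⟨ *-congˡ z≈g ⟩
               evR s * evR g                    ≈⟨ ER.ev-* s g ⟨
               evR (s RP.*ₚ g)                  ≈⟨ ER.ev-cong (s RP.*ₚ g) (f RP.*ₚ w RP.+ₚ t)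
                                                     (RPR.trans (RPR.*-congˡ {s} g≋) (RPR.trans (shuffle s w r r′)
                                                       (RPR.+-congʳ {t} (RPR.*-congʳ {w} (RPR.sym f≋))))) ⟩
               evR (f RP.*ₚ w RP.+ₚ t)          ≈⟨ trans (ER.ev-+ (f RP.*ₚ w) t) (+-congʳ (ER.ev-* f w)) ⟩
               evR f * evR w + evR t            ≈⟨ +-congʳ (trans (*-congʳ root) (zeroˡ _)) ⟩
               0# + evR t                       ≈⟨ +-identityˡ _ ⟩
               evR t                            ∎)
          where
          open SetoidReasoning setoid
          shuffle : ∀ s w r r′ → s RP.*ₚ (d RP.*ₚ w RP.+ₚ r′) RP.≋
                    (d RP.*ₚ s RP.+ₚ r) RP.*ₚ w RP.+ₚ (s RP.*ₚ r′ RP.+ₚ RP.-ₚ (w RP.*ₚ r))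
          shuffle s w r r′ = RPS.solve 5 (λ s w r r′ d → s RPS.:* (d RPS.:* w RPS.:+ r′) RPS.:=
            (d RPS.:* s RPS.:+ r) RPS.:* w RPS.:+ (s RPS.:* r′ RPS.:- w RPS.:* r)) RPR.refl s w r r′ d

        V-Df : V (RP.D f)
        V-Df =
          let (s , r , Pr , f≋) = divides f Vf
              (t , r′ , Pr′ , s≋) = divides s (V-s s r Pr f≋)
              ρ = d RP.*ₚ r′ RP.+ₚ r
              f≋d² : f RP.≋ d RP.*ₚ (d RP.*ₚ t) RP.+ₚ ρ
              f≋d² = RPR.trans f≋ (RPR.trans (RPR.+-congʳ {r} (RPR.*-congˡ {d} s≋))
                (RPS.solve 4 (λ d t r r′ → d RPS.:* (d RPS.:* t RPS.:+ r′) RPS.:+ r RPS.:=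
                   d RPS.:* (d RPS.:* t) RPS.:+ (d RPS.:* r′ RPS.:+ r)) RPR.refl d t r r′))
          in Vᴵ.resp {D² t RP.*ₚ d RP.+ₚ RP.D ρ} {RP.D f}
                 (RPR.sym (RPR.trans (RP.D-cong f (d RP.*ₚ (d RP.*ₚ t) RP.+ₚ ρ) f≋d²)
                   (RPR.trans (RP.D-+ (d RP.*ₚ (d RP.*ₚ t)) ρ) (RPR.+-congʳ {RP.D ρ} (D-square t)))))
                 (Vᴵ.+-closed {D² t RP.*ₚ d} {RP.D ρ} (Vᴵ.*-closed (D² t) {d} V-monic)
                   (P⊆V (RP.D ρ) (Coeffs-D ρ (Coeffsᴵ.+-closed (Coeffsᴵ.*-closed d Pr′) Pr))))
          where
          -- (d² t)′ = (2 d′ t + d t′) d is a multiple of d ∈ V, so f ≡ d² t modulo P[x] puts f′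
          -- into V.
          D² : RP.Poly → RP.Poly
          D² t = RP.D d RP.*ₚ t RP.+ₚ RP.D d RP.*ₚ t RP.+ₚ d RP.*ₚ RP.D t
          D-square : ∀ t → RP.D (d RP.*ₚ (d RP.*ₚ t)) RP.≋ D² t RP.*ₚ d
          D-square t = RPR.trans (RP.D-* d (d RP.*ₚ t))
            (RPR.trans (RPR.+-congˡ {RP.D d RP.*ₚ (d RP.*ₚ t)} (RPR.*-congˡ {d} (RP.D-* d t)))
              (RPS.solve 4 (λ d d′ t t′ → d′ RPS.:* (d RPS.:* t) RPS.:+ d RPS.:* (d′ RPS.:* t RPS.:+ d RPS.:* t′) RPS.:=
                 (d′ RPS.:* t RPS.:+ d′ RPS.:* t RPS.:+ d RPS.:* t′) RPS.:* d) RPR.refl d (RP.D d) t (RP.D t)))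

    -- If the least exponent e with zᵉ ∈ PA were at least 2, the square of zᵉ⁻¹ would be zᵉ⁻² zᵉ ∈
    -- PA, and `square-root` would lower e.
    reduced : ¬ P a → ∀ {z} → A z → ∀ k → PA (z ^ k) → PA z
    reduced ¬Pa {z} Az k PAzᵏ = go (least em (λ k → PA (z ^ k)) k PAzᵏ)
      where
      go : (∃ λ e → e ≤ k ∧ PA (z ^ e) ∧ (∀ j → j < e → ¬ PA (z ^ j))) → PA z
      go (zero , _ , PA1 , _) = PA-resp (*-identityʳ z) (PA-* Az PA1)
      go (ℕ.suc zero , _ , PAz , _) = PA-resp (*-identityʳ z) PAz
      go (ℕ.suc (ℕ.suc m) , _ , PAz , minimal) = ⊥-elim (minimal (ℕ.suc m) ℕ.≤-refl
        (square-root ¬Pa (A-^ (ℕ.suc m) Az) (PA-resp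
          (solve 2 (λ z w → w :* (z :* (z :* w)) := z :* w :* (z :* w)) refl z (z ^ m))
          (PA-* (A-^ m Az) PAz))))

  -- Annihilators modulo A

  I : Carrier → Pred R.Carrier ℓ
  I y r = A (φ r * y)

  I-ideal : ∀ y → IsIdeal R (I y)
  I-ideal y = record
    { resp     = λ e → A-resp (*-congʳ (φM.⟦⟧-cong e))
    ; 0∈       = A-resp (sym (trans (*-congʳ φM.0#-homo) (zeroˡ y))) A-0
    ; +-closed = λ {r} {s} Ar As → A-resp
        (trans (sym (distribʳ y _ _)) (*-congʳ (sym (φM.+-homo r s)))) (A-+ Ar As)
    ; *-closed = λ r {s} As → A-resp
        (trans (sym (*-assoc _ _ _)) (*-congʳ (sym (φM.*-homo r s)))) (A-* (A-φ r) As)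
    }

  -- S consists of the elements equal to 1, so `Disjoint y` amounts to y ∉ A; the admissible class
  -- is that of the almost integral elements.
  open Noetherian.MaximalAnnihilator R isNoetherian em (λ r y → φ r * y) I I-ideal
    (λ r y {s} → A-resp (trans (sym (*-assoc _ _ _)) (*-congʳ (sym (φM.*-homo s r)))))
    (λ r y {s} → A-resp (trans (*-congʳ (φM.*-homo s r)) (*-assoc _ _ _)))
    (R.1# R.≈_) R.refl (λ e e′ → R.trans (R.sym (R.*-identityˡ R.1#)) (R.*-cong e e′))
    AlmostIntegral (λ r → almost-integral-* (A-φ r))

  disjoint⇒∉ : ∀ {y} → Disjoint y → ¬ A y
  disjoint⇒∉ Dy Ay = Dy R.refl (A-* (A-φ R.1#) Ay)

  ∉⇒disjoint : ∀ {y} → ¬ A y → Disjoint y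
  ∉⇒disjoint {y} ¬Ay 1≈s Is = ¬Ay (A-resp
    (trans (*-congʳ (trans (φM.⟦⟧-cong (R.sym 1≈s)) φM.1#-homo)) (*-identityˡ y)) Is)

  -- The contradiction from a maximal annihilator

  module _ (M : Maximal) where
    open Maximal M renaming (element to β)

    P = I β
    open IsPrimeIdeal isPrime using (isIdeal; 1∉; prime)
    private module P = IdealProperties R P isIdeal

    d = proj₁ ∈C
    d≉0 = proj₁ (proj₂ ∈C)
    β-powers = proj₂ (proj₂ ∈C)

    P≉0 : NonZeroIdeal P
    P≉0 = d , A-resp (*-congˡ (*-identityʳ β)) (β-powers 1) , d≉0

    module _ (U : Uniformizer isPrime P≉0) where
      open Uniformizer U

      -- The inclusion c P ⊆ π R, applied to each coefficient.
      PA⇒divisible : ∀ {y} → PA isPrime P≉0 y → ∃ λ w → A w ∧ φ c * y ≈ φ π * w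
      PA⇒divisible {y} (p , Pp , y≈) =
        let (p′ , eqs) = divide-coeffs isPrime P≉0 U p Pp in evR p′ , A-ev p′ , (begin
          φ c * y                ≈⟨ *-congˡ y≈ ⟩
          φ c * evR p            ≈⟨ ER.ev-scale c p ⟨
          evR (RP.scale c p)     ≈⟨ ER.ev-cong (RP.scale c p) (RP.scale π p′) (RP.≈⇒≋ λ i →
                                      R.trans (RP.coeff-scale c p i) (R.trans (eqs i) (R.sym (RP.coeff-scale π p′ i)))) ⟩
          evR (RP.scale π p′)    ≈⟨ ER.ev-scale π p′ ⟩
          φ π * evR p′           ∎)
        where open SetoidReasoning setoid

      φ≉0 : ∀ {r} → ¬ r R.≈ R.0# → ¬ φ r ≈ 0#
      φ≉0 r≉0 e = r≉0 (φM.injective (trans e (sym φM.0#-homo)))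

      z : Carrier
      z = φ π * β

      -- Writing d = π^j x (up to powers of c) with x ∉ P, d β^(j+1) ∈ A gives z^(j+1) ∈ PA.
      some-power : ∃ λ k → PA isPrime P≉0 (z ^ k)
      some-power = by-contradiction em λ none →
        π∤c (stable-quotient π≉0 Q d≉0 Qd (step none))
        where
        -- This contains (c/π)ʲ d whenever it lies in R, with u = cʲ: the division by πʲ is made up
        -- for by zʲ = πʲ βʲ.
        Chain : Pred R.Carrier ℓ
        Chain x = ∃ λ j → ∃ λ u → A u ∧ φ x * z ^ j ≈ u * (φ d * β ^ j)

        Q : Pred R.Carrier ℓ
        Q x = P x ∧ Chain x

        end : ∀ {x} → ¬ P x → Chain x → ∃ λ k → PA isPrime P≉0 (z ^ k)
        -- One more factor z = π β brings out π: x z^(j + 1) = π u d β^(j + 1) ∈ PA, and x ∉ P is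
        -- cancelled modulo P.
        end {x} ¬Px (j , u , Au , eq) = ℕ.suc j , PA-cancel isPrime P≉0 ¬Px (A-^ (ℕ.suc j) π∈P)
          (PA-resp isPrime P≉0 (sym (begin
            φ x * (z * z ^ j)                    ≈⟨ solve 3 (λ x z w → x :* (z :* w) := z :* (x :* w)) refl (φ x) z (z ^ j) ⟩
            φ π * β * (φ x * z ^ j)              ≈⟨ *-congˡ eq ⟩
            φ π * β * (u * (φ d * β ^ j))
              ≈⟨ solve 5 (λ p b u d w → p :* b :* (u :* (d :* w)) := p :* (u :* (d :* (b :* w)))) refl (φ π) β u (φ d) (β ^ j) ⟩
            φ π * (u * (φ d * β ^ ℕ.suc j))      ∎))
            (PA-φ isPrime P≉0 π∈P (A-* Au (β-powers (ℕ.suc j)))))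
          where open SetoidReasoning setoid

        Qd : Q d
        Qd = proj₁ (proj₂ P≉0) , 0 , 1# , A-1 , sym (*-identityˡ _)

        step : ¬ (∃ λ k → PA isPrime P≉0 (z ^ k)) → ∀ {x} → Q x → ∃ λ y → Q y ∧ c R.* x R.≈ π R.* y
        step none {x} (Px , j , u , Au , eq) =
          let (y , cx≈πy) = divides Px
              chain : Chain y
              chain = ℕ.suc j , φ c * u , A-* (A-φ c) Au , (begin
                φ y * (φ π * β * z ^ j)
                  ≈⟨ solve 4 (λ y p b w → y :* (p :* b :* w) := p :* y :* (b :* w)) refl (φ y) (φ π) β (z ^ j) ⟩
                φ π * φ y * (β * z ^ j)                ≈⟨ *-congʳ (trans (sym (φM.*-homo π y))
                                                            (trans (φM.⟦⟧-cong (R.sym cx≈πy)) (φM.*-homo c x))) ⟩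
                φ c * φ x * (β * z ^ j)
                  ≈⟨ solve 4 (λ c x b w → c :* x :* (b :* w) := c :* b :* (x :* w)) refl (φ c) (φ x) β (z ^ j) ⟩
                φ c * β * (φ x * z ^ j)                ≈⟨ *-congˡ eq ⟩
                φ c * β * (u * (φ d * β ^ j))
                  ≈⟨ solve 5 (λ c b u d w → c :* b :* (u :* (d :* w)) := c :* u :* (d :* (b :* w))) refl (φ c) β u (φ d) (β ^ j) ⟩
                φ c * u * (φ d * β ^ ℕ.suc j)          ∎)
          in y , (by-contradiction em (λ ¬Py → none (end ¬Py chain)) , chain) , cx≈πy
          where open SetoidReasoning setoid

      a∈P : P a
      a∈P = by-contradiction em λ ¬Pa →
        let (k , PAzᵏ) = some-power
            (w , Aw , eq) = PA⇒divisible (reduced isPrime P≉0 ¬Pa π∈P k PAzᵏ)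
        in c∉P (A-resp (LDom.*-cancel (φ≉0 π≉0) (trans (sym eq)
             (solve 3 (λ c p b → c :* (p :* b) := p :* (c :* b)) refl (φ c) (φ π) β))) Aw)

      module _ (a∈P : P a) {a′ : R.Carrier} (ca≈πa′ : c R.* a R.≈ π R.* a′) (a′∉P : ¬ P a′) where
        a≉0 : ¬ a R.≈ R.0#
        a≉0 a≈0 = a′∉P (P.resp (R.sym (RDom.*-≈0ʳ π≉0
          (R.trans (R.sym ca≈πa′) (R.trans (R.*-congˡ a≈0) (R.zeroʳ c))))) P.0∈)

        α≉0 : ¬ α ≈ 0#
        α≉0 α≈0 = φ≉0 a≉0 (trans (sym (proj₂ (proj₂ α-cofactor))) (trans (*-congʳ α≈0) (zeroˡ _)))

        record Descent : Set ℓ where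
          field
            γ   : Carrier
            γ∉A : ¬ A γ
            αγ∈A : A (α * γ)
            γ-almost-integral : AlmostIntegral γ
            P⊑Iγ : P ⊑ I γ

        descent : Descent
        descent = go n (A-resp (*-congʳ (sym α^n≈φa)) a∈P)
          where
          go : ∀ m → A (α ^ m * β) → Descent
          go zero Aβ = ⊥-elim (disjoint⇒∉ disjoint (A-resp (*-identityˡ β) Aβ))
          go (ℕ.suc m) Aαβ with em {A (α ^ m * β)}
          ... | yes Aβ = go m Aβ
          ... | no ¬Aβ = record
            { γ = α ^ m * β
            ; γ∉A = ¬Aβ
            ; αγ∈A = A-resp (*-assoc _ _ _) Aαβ
            ; γ-almost-integral = almost-integral-* (A-^ m A-α) ∈C
            ; P⊑Iγ = λ r Ar → A-resp (solve 3 (λ z r b → z :* (r :* b) := r :* (z :* b)) refl (α ^ m) (φ r) β)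
                       (A-* (A-^ m A-α) Ar)
            }

        φ-^ : ∀ r k → φ (r RE.^ k) ≈ φ r ^ k
        φ-^ r zero      = φM.1#-homo
        φ-^ r (ℕ.suc k) = trans (φM.*-homo r _) (*-congˡ (φ-^ r k))

        prime-power : ∀ r k → P (r RE.^ k) → P r
        prime-power r zero      P1 = ⊥-elim (1∉ P1)
        prime-power r (ℕ.suc k) Pr = Sum.[ (λ Pr → Pr) , prime-power r k ]′ (prime _ _ Pr)

        module _ (D : Descent) where
          open Descent D

          -- γ′ = r/α is almost integral, so γ′ⁿ = rⁿ/a lies in R and r ∈ P.
          remainder∈P : ∀ r γ′ → α * γ′ ≈ φ r → AlmostIntegral γ′ → P r
          remainder∈P r γ′ αγ′≈ (b , b≉0 , powers) =
            prime-power r n (P.resp (R.sym rⁿ≈) (P.*-closedʳ t a∈P))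
            where
            module KE = Exp K.semiring
            a⁻¹ = proj₁ (IsField.inverse isField (ι a) (ι≉0 a≉0))
            q = ι (r RE.^ n) K.* a⁻¹

            aq≈ : ι a K.* q K.≈ ι (r RE.^ n)
            aq≈ = K.trans (IntegerSolver.solve K 3 (λ a r i → a KS.:* (r KS.:* i) KS.:= (a KS.:* i) KS.:* r) K.refl (ι a) (ι (r RE.^ n)) a⁻¹)
                    (K.trans (K.*-congʳ (proj₂ (IsField.inverse isField (ι a) (ι≉0 a≉0)))) (K.*-identityˡ _))
              where module KS = IntegerSolver K

            κq≈ : κ q ≈ γ′ ^ n
            κq≈ = LDom.*-cancel (φ≉0 a≉0) (begin
              φ a * κ q               ≈⟨ κM.*-homo (ι a) q ⟨
              κ (ι a K.* q)           ≈⟨ κM.⟦⟧-cong aq≈ ⟩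
              φ (r RE.^ n)            ≈⟨ φ-^ r n ⟩
              φ r ^ n                 ≈⟨ ^-congˡ n (sym αγ′≈) ⟩
              (α * γ′) ^ n            ≈⟨ ^-distrib-* α γ′ n ⟩
              α ^ n * γ′ ^ n          ≈⟨ *-congʳ α^n≈φa ⟩
              φ a * γ′ ^ n            ∎)
              where open SetoidReasoning setoid

            κ-^ : ∀ x k → κ (x KE.^ k) ≈ κ x ^ k
            κ-^ x zero      = κM.1#-homo
            κ-^ x (ℕ.suc k) = trans (κM.*-homo x _) (*-congˡ (κ-^ x k))

            q-powers : ∀ k → ∃ λ x → ι x K.≈ ι b K.* q KE.^ k
            q-powers k = proj₁ found , K.sym (proj₂ found)
              where
              open SetoidReasoning setoid
              -- b qᵏ = b γ′^(n k) lies in A and comes from K, hence from R.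
              found = A∩K (ι b K.* q KE.^ k) (A-resp (sym (begin
                κ (ι b K.* q KE.^ k)    ≈⟨ κM.*-homo _ _ ⟩
                φ b * κ (q KE.^ k)      ≈⟨ *-congˡ (trans (κ-^ q k) (^-congˡ k κq≈)) ⟩
                φ b * (γ′ ^ n) ^ k      ≈⟨ *-congˡ (^-assocʳ γ′ n k) ⟩
                φ b * γ′ ^ (n ℕ.* k)    ∎)) (powers (n ℕ.* k)))

            q-integral = almost-integral q b b≉0 q-powers
            t = proj₁ q-integral

            rⁿ≈ : r RE.^ n R.≈ a R.* t
            rⁿ≈ = ιM.injective (K.trans (K.sym aq≈) (K.trans (K.*-congˡ (proj₂ q-integral)) (K.sym (ιM.*-homo a t))))

          -- With γ′ = γ - p(α) = r/α and 1/α = b/a, the relations a′/a = c/π and c r = π r′ give a′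
          -- c γ′ = c r′ b ∈ A. The calculation is carried out after multiplication by π α ≠ 0.
          a′cγ∈A : ∀ r p r′ b → α * (γ - evR p) ≈ φ r → c R.* r R.≈ π R.* r′ → A b → α * b ≈ φ a →
                   A (φ (a′ R.* c) * γ)
          a′cγ∈A r p r′ b αγ′≈ cr≈πr′ Ab αb≈φa = A-resp
            (solve 3 (λ x g p → x :* (g :- p) :+ x :* p := x :* g) refl (φ (a′ R.* c)) γ (evR p))
            (A-+ (A-resp (sym a′cγ′≈) (A-* (A-φ (c R.* r′)) Ab))
                 (A-* (A-φ (a′ R.* c)) (A-ev p)))
            where
            γ′ = γ - evR p

            a′cγ′≈ : φ (a′ R.* c) * γ′ ≈ φ (c R.* r′) * b
            a′cγ′≈ = LDom.*-cancel (LDom.*-≉0 (φ≉0 π≉0) α≉0) (begin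
              φ π * α * (φ (a′ R.* c) * γ′)        ≈⟨ *-congˡ (*-congʳ (φM.*-homo a′ c)) ⟩
              φ π * α * (φ a′ * φ c * γ′)
                ≈⟨ solve 5 (λ p a x c g → p :* a :* (x :* c :* g) := p :* x :* c :* (a :* g)) refl (φ π) α (φ a′) (φ c) γ′ ⟩
              φ π * φ a′ * φ c * (α * γ′)          ≈⟨ *-cong (*-congʳ (trans (sym (φM.*-homo π a′))
                                                        (trans (φM.⟦⟧-cong (R.sym ca≈πa′)) (φM.*-homo c a)))) αγ′≈ ⟩
              φ c * φ a * φ c * φ r
                ≈⟨ solve 3 (λ c a r → c :* a :* c :* r := c :* a :* (c :* r)) refl (φ c) (φ a) (φ r) ⟩
              φ c * φ a * (φ c * φ r)              ≈⟨ *-congˡ (trans (sym (φM.*-homo c r))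
                                                        (trans (φM.⟦⟧-cong cr≈πr′) (φM.*-homo π r′))) ⟩
              φ c * φ a * (φ π * φ r′)             ≈⟨ *-congʳ (*-congˡ (sym αb≈φa)) ⟩
              φ c * (α * b) * (φ π * φ r′)
                ≈⟨ solve 5 (λ c a b p r → c :* (a :* b) :* (p :* r) := p :* a :* (c :* r :* b)) refl (φ c) α b (φ π) (φ r′) ⟩
              φ π * α * (φ c * φ r′ * b)           ≈⟨ *-congˡ (*-congʳ (φM.*-homo c r′)) ⟨
              φ π * α * (φ (c R.* r′) * b)         ∎)
              where open SetoidReasoning setoid

          -- γ - p(α) = r/α is again almost integral, so r ∈ P and c r = π r′. As I γ contains P and
          -- γ ∉ A, maximality gives I γ ⊆ P, whereas a′ c ∈ I γ with both factors outside the prime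
          -- P.
          finish : ∀ r p → α * γ ≈ φ r + α * evR p → ⊥
          finish r p αγ≈ =
            let (r′ , cr≈πr′) = divides (remainder∈P r (γ - evR p) αγ′≈ (almost-integral-- (A-ev p) γ-almost-integral))
                (b , Ab , αb≈φa) = α-cofactor
            in Sum.[ a′∉P , c∉P ]′ (prime a′ c
                 (maximal γ γ-almost-integral (λ {s} → ∉⇒disjoint γ∉A {s}) P⊑Iγ (a′ R.* c)
                   (a′cγ∈A r p r′ b αγ′≈ cr≈πr′ Ab αb≈φa)))
            where
            open SetoidReasoning setoid
            αγ′≈ : α * (γ - evR p) ≈ φ r
            αγ′≈ = begin
              α * (γ - evR p)                    ≈⟨ solve 3 (λ a g p → a :* (g :- p) := a :* g :- a :* p) refl α γ (evR p) ⟩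
              α * γ - α * evR p                  ≈⟨ +-congʳ αγ≈ ⟩
              φ r + α * evR p - α * evR p        ≈⟨ solve 2 (λ r p → r :+ p :- p := r) refl (φ r) (α * evR p) ⟩
              φ r                                ∎

          no-descent : A (α * γ) → ⊥
          -- The polynomial representing α γ is split into its constant term r and x p; the empty
          -- list counts as r = 0.
          no-descent ([] , eq)    = finish R.0# [] (trans eq (sym (trans (+-cong φM.0#-homo (zeroʳ α)) (+-identityʳ 0#))))
          no-descent (r ∷ p , eq) = finish r p eq

    no-maximal : ⊥
    no-maximal =
      let U = uniformizer isPrime P≉0
          Pa = a∈P U
          (a′ , ca≈πa′) = Uniformizer.divides U Pa
          a′∉P = square-free⇒cofactor∉P isPrime P≉0 U square-free Pa ca≈πa′
          D = descent U Pa ca≈πa′ a′∉P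
      in no-descent U Pa ca≈πa′ a′∉P D (Descent.αγ∈A D)

  integrally-closed : IntegrallyClosedIn L A (AdjoinField K L κ α)
  integrally-closed y y∈ y-integral = by-contradiction em λ y∉A →
    no-maximal (maximal-annihilator
      (integral⇒almost-integral (denominator y∈) y-integral) (λ {s} → ∉⇒disjoint y∉A {s}))

theorem1p3 :
  ∀ {ℓ : Level} → ExcludedMiddle (suc ℓ) →
  (R K L : CommutativeRing ℓ ℓ) →
  let module R = CommutativeRing R
      module K = CommutativeRing K
      module L = CommutativeRing L
      open Polynomial R
  in
  (ι : R.Carrier → K.Carrier) → IsDedekindWithQuotientField R K ι →
  IsField L → (κ : K.Carrier → L.Carrier) → IsEmbedding K L κ →
  (n : ℕ) (a : R.Carrier) → SquareFree R a → Irreducible (X^ n - a) →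
  (α : L.Carrier) → evalAt R L (κ ∘ ι) (X^ n - a) α L.≈ L.0# →
  (∀ P → IsPrimeIdeal R P → P (_×_ R.+-rawMonoid n R.1#) → P a) →
  IntegrallyClosedIn L (Adjoin R L (κ ∘ ι) α) (AdjoinField K L κ α)
theorem1p3 em R K L ι dedekind L-field κ κ-embedding n a square-free irreducible α root n∈P⇒a∈P =
  IntegralClosure.integrally-closed (lower-em em) R K L ι dedekind L-field κ κ-embedding n a
    square-free irreducible α root n∈P⇒a∈P
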